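{- Let $C=\mathrm{conv}(\tau\cup\tau')$ be a lattice polygon, where $\tau,\tau'$ are parallel lattice segments lying on adjacent parallel lattice lines (lattice distance $1$ apart), and suppose $\tau'$ contains at least three lattice points. Let $\nu_1,\dots,\nu_n$ be the lattice points of $\tau$ and $\mu_1,\dots,\mu_m$ those of $\tau'$, each listed consecutively and in the same direction. Then there exists a regular unimodular triangulation $\Delta$ of $C$ such that: $\nu_1$ is joined by an edge of $\Delta$ to $\mu_2$; $\nu_n$ is joined by an edge of $\Delta$ to $\mu_{m-1}$; and the number of lattice points of $\tau$ that are joined by edges to at least two lattice points of $\tau'$ is the maximum possible among all unimodular triangulations of $C$.
   Context: A unimodular triangulation of a lattice polygon is a subdivision into lattice triangles of area $1/2$. A subdivision is regular if it is the projection of the lower faces of the convex hull of the lifted points $(p,\omega(p))$ for some height function $\omega$ on the lattice points of the polygon. -}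

module Defs where

open import Data.Nat as ℕ using (ℕ; zero; suc; _∸_)
open import Data.Integer as ℤ using (ℤ; +_; ∣_∣)
open import Data.Rational as ℚ using (ℚ; 0ℚ; 1ℚ)
open import Data.Fin using (Fin; zero; suc)
open import Data.List using (List; []; _∷_; _++_; map; upTo; length; filter)
open import Data.List.Relation.Unary.Any using (Any; any?)
open import Data.Product using (Σ; Σ-syntax; ∃; _×_; _,_; proj₁; proj₂)
open import Data.Product.Properties using (≡-dec)
open import Data.Sum using (_⊎_)
open import Relation.Nullary using (Dec; ¬_)
open import Relation.Nullary.Decidable using (_×-dec_; _⊎-dec_)
open import Relation.Binary.PropositionalEquality using (_≡_; _≢_)
open import Relation.Binary.Definitions using (DecidableEquality)
open import Function using (_∘_)

Pt : Set
Pt = ℤ × ℤ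

_+ᵖ_ : Pt → Pt → Pt
(a , b) +ᵖ (c , d) = (a ℤ.+ c , b ℤ.+ d)

_-ᵖ_ : Pt → Pt → Pt
(a , b) -ᵖ (c , d) = (a ℤ.- c , b ℤ.- d)

_·ᵖ_ : ℕ → Pt → Pt
k ·ᵖ (a , b) = ((+ k) ℤ.* a , (+ k) ℤ.* b)

det : Pt → Pt → ℤ
det (a , b) (c , d) = a ℤ.* d ℤ.- b ℤ.* c

_≟ᵖ_ : DecidableEquality Pt
_≟ᵖ_ = ≡-dec ℤ._≟_ ℤ._≟_

Ptℚ : Set
Ptℚ = ℚ × ℚ

toℚ : ℤ → ℚ
toℚ z = z ℚ./ 1

sumF : ∀ {k} → (Fin k → ℚ) → ℚ
sumF {zero}  w = 0ℚ
sumF {suc k} w = w zero ℚ.+ sumF (w ∘ suc)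

combX : (ps : List Pt) → (Fin (length ps) → ℚ) → ℚ
combX []       w = 0ℚ
combX (p ∷ ps) w = w zero ℚ.* toℚ (proj₁ p) ℚ.+ combX ps (w ∘ suc)

combY : (ps : List Pt) → (Fin (length ps) → ℚ) → ℚ
combY []       w = 0ℚ
combY (p ∷ ps) w = w zero ℚ.* toℚ (proj₂ p) ℚ.+ combY ps (w ∘ suc)

InConv : List Pt → Ptℚ → Set
InConv ps x = Σ[ w ∈ (Fin (length ps) → ℚ) ]
  ((∀ i → 0ℚ ℚ.≤ w i) × sumF w ≡ 1ℚ × combX ps w ≡ proj₁ x × combY ps w ≡ proj₂ x)

-- x is a convex combination of ps with all weights strictly positive
-- (for the three vertices of a nondegenerate triangle: x lies in its interior)
InRelInt : List Pt → Ptℚ → Set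
InRelInt ps x = Σ[ w ∈ (Fin (length ps) → ℚ) ]
  ((∀ i → 0ℚ ℚ.< w i) × sumF w ≡ 1ℚ × combX ps w ≡ proj₁ x × combY ps w ≡ proj₂ x)

Tri : Set
Tri = Pt × Pt × Pt

verts : Tri → List Pt
verts (a , b , c) = a ∷ b ∷ c ∷ []

_∈V_ : Pt → Tri → Set
v ∈V (a , b , c) = v ≡ a ⊎ v ≡ b ⊎ v ≡ c

_∈V?_ : (v : Pt) (T : Tri) → Dec (v ∈V T)
v ∈V? (a , b , c) = (v ≟ᵖ a) ⊎-dec ((v ≟ᵖ b) ⊎-dec (v ≟ᵖ c))

Unimodular : Tri → Set
Unimodular (a , b , c) = ∣ det (b -ᵖ a) (c -ᵖ a) ∣ ≡ 1

_∈L_ : Pt → List Pt → Set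
v ∈L ps = Any (v ≡_) ps

-- Δ (a list of triangles) is a unimodular triangulation of the lattice
-- polygon conv(pts), where pts is the list of lattice points of the polygon:
--  * every triangle is a unimodular lattice triangle with vertices lattice points of the polygon,
--  * the triangles cover the polygon,
--  * distinct triangles of Δ have disjoint interiors.
UnimodularTriangulation : List Pt → List Tri → Set
UnimodularTriangulation pts Δ =
  (∀ {T} → Any (T ≡_) Δ → Unimodular T × (∀ {v} → v ∈V T → v ∈L pts))
  × (∀ x → InConv pts x → Any (λ T → InConv (verts T) x) Δ)
  × (∀ (i j : Fin (length Δ)) → i ≢ j →
       ∀ x → ¬ (InRelInt (verts (Data.List.lookup Δ i)) x × InRelInt (verts (Data.List.lookup Δ j)) x))

affine : ℚ → ℚ → ℚ → Pt → ℚ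
affine α β γ (x , y) = α ℚ.* toℚ x ℚ.+ β ℚ.* toℚ y ℚ.+ γ

-- Δ is the regular subdivision induced by ω: for each triangle T of Δ its lift is
-- a lower face of conv{(p, ω p) : p lattice point of the polygon}, i.e. there is an
-- affine function agreeing with ω on the vertices of T and strictly below ω at all
-- other lattice points of the polygon.
InducedBy : List Pt → List Tri → (Pt → ℚ) → Set
InducedBy pts Δ ω =
  ∀ {T} → Any (T ≡_) Δ →
    Σ[ α ∈ ℚ ] Σ[ β ∈ ℚ ] Σ[ γ ∈ ℚ ]
      ((∀ {v} → v ∈V T → affine α β γ v ≡ ω v)
       × (∀ {u} → u ∈L pts → ¬ (u ∈V T) → affine α β γ u ℚ.< ω u))

Regular : List Pt → List Tri → Set
Regular pts Δ = Σ[ ω ∈ (Pt → ℚ) ] InducedBy pts Δ ω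

Joined : List Tri → Pt → Pt → Set
Joined Δ v w = Any (λ T → v ∈V T × w ∈V T) Δ

joined? : (Δ : List Tri) (v w : Pt) → Dec (Joined Δ v w)
joined? Δ v w = any? (λ T → (v ∈V? T) ×-dec (w ∈V? T)) Δ

nbrCount : List Tri → Pt → List Pt → ℕ
nbrCount Δ v qs = length (filter (joined? Δ v) qs)

countJoinedTwo : List Tri → List Pt → List Pt → ℕ
countJoinedTwo Δ ps qs = length (filter (λ v → 2 ℕ.≤? nbrCount Δ v qs) ps)

-- The strip polygon C = conv(τ ∪ τ')
-- τ has lattice points ν i = p + i·d (i = 0..n-1), τ' has μ j = q + j·d (j = 0..m-1),
-- with |det(d, q - p)| = 1 (adjacent parallel lattice lines; forces d primitive).

ν : Pt → Pt → ℕ → Pt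
ν p d i = p +ᵖ (i ·ᵖ d)

τpts : Pt → Pt → ℕ → List Pt
τpts p d n = map (ν p d) (upTo n)

Cpts : Pt → Pt → Pt → ℕ → ℕ → List Pt
Cpts p q d n m = τpts p d n ++ τpts q d m

{-# OPTIONS --safe #-}
module Submission where

-- In the coordinates (u, v) of the unimodular frame (p; d, q − p) the polygon C is the strip between
-- v = 0, carrying ν i = (i, 0), and v = 1, carrying μ j = (j, 1). Every lattice path from (0, 0) to
-- (n − 1, m − 1) gives a unimodular triangulation: a τ-step at (i, j) contributes ν i ν (i+1) μ j, a
-- τ′-step contributes ν i μ j μ (j+1). The staircase alternates τ′- and τ-steps r = min (n − 1, m − 2)
-- times and then fans out, so it contains ν 0 μ 0 μ 1 and ν (n−1) μ (m−2) μ (m−1), and r + 1 = min (n, m − 1)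
-- points of τ get two neighbours on τ′. No triangulation does better: two crossing edges would give a
-- point interior to two triangles, so the largest τ′-neighbours of those points strictly increase
-- along τ and lie in 1 … m − 1. Lifting ν k to k² and μ k to k² − k, plus 2 (n − 1) at μ (m − 1), makes
-- every staircase triangle a lower face, by strict convexity of k².

open import Defs
open import Data.Nat as ℕ using (ℕ; zero; suc; _≤_; _∸_; _⊓_; z≤n; s≤s)
import Data.Nat.Properties as ℕP
open import Data.Nat.Coprimality using (1-coprimeTo) renaming (sym to coprime-sym)
open import Data.Integer as ℤ using (ℤ; +_; -[1+_]; ∣_∣)
import Data.Integer.Properties as ℤP
import Data.Integer.Tactic.RingSolver as ℤ-Solver
open import Data.Rational as ℚ using (ℚ; 0ℚ; 1ℚ; mkℚ)
import Data.Rational.Properties as ℚP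
open import Data.Fin as Fin using (Fin; zero; suc)
import Data.Fin.Properties as FinP
open import Data.List using (List; []; _∷_; _++_; map; upTo; length; filter; replicate; lookup)
import Data.List.Properties as ListP
open import Data.List.Membership.Propositional.Properties using (∈-lookup)
open import Data.List.Relation.Unary.Any as Any using (Any; here; there)
import Data.List.Relation.Unary.Any.Properties as AnyP
open import Data.Product using (Σ-syntax; ∃; ∃₂; _×_; _,_; proj₁; proj₂)
open import Data.Sum using (_⊎_; inj₁; inj₂)
open import Data.Empty using (⊥; ⊥-elim)
open import Data.Unit using (⊤; tt)
open import Function using (_∘_)
open import Level using (0ℓ)
open import Relation.Nullary using (Dec; yes; no; ¬_)
open import Relation.Nullary.Decidable using (dec⇒maybe)
open import Relation.Binary.PropositionalEquality hiding (J)
import Tactic.RingSolver as RingSolver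
import Tactic.RingSolver.Core.AlmostCommutativeRing as ACR

ℚ-ring : ACR.AlmostCommutativeRing 0ℓ 0ℓ
ℚ-ring = ACR.fromCommutativeRing ℚP.+-*-commutativeRing (λ x → dec⇒maybe (0ℚ ℚP.≟ x))

open RingSolver using (solve-∀)

cong₃ : ∀ {A B C D : Set} (f : A → B → C → D) {a a′ b b′ c c′} → a ≡ a′ → b ≡ b′ → c ≡ c′ → f a b c ≡ f a′ b′ c′
cong₃ f refl refl refl = refl

m≤n⇒∃[o]n≡m+o : ∀ {m n} → m ℕ.≤ n → ∃ λ o → n ≡ m ℕ.+ o
m≤n⇒∃[o]n≡m+o {zero}  {n}     _         = n , refl
m≤n⇒∃[o]n≡m+o {suc m} {suc n} (s≤s m≤n) with m≤n⇒∃[o]n≡m+o m≤n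
... | o , refl = o , refl

m<n⇒∃[o]n≡m+1+o : ∀ {m n} → m ℕ.< n → ∃ λ o → n ≡ m ℕ.+ suc o
m<n⇒∃[o]n≡m+1+o {m} m<n with m≤n⇒∃[o]n≡m+o m<n
... | o , refl = o , sym (ℕP.+-suc m o)

∣i∣≡1⇒i*i≡1 : ∀ i → ∣ i ∣ ≡ 1 → i ℤ.* i ≡ + 1
∣i∣≡1⇒i*i≡1 (+ 1)    _ = refl
∣i∣≡1⇒i*i≡1 -[1+ 0 ] _ = refl

0<[1+m][1+n]+c : ∀ m n c → ∣ c ∣ ℕ.≤ m → + 0 ℤ.< + suc m ℤ.* + suc n ℤ.+ c
0<[1+m][1+n]+c m n (+ c)    _      = ℤ.+<+ (s≤s z≤n)
0<[1+m][1+n]+c m n -[1+ c ] ∣c∣≤m =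
  subst (+ 0 ℤ.<_) (sym (ℤP.⊖-≥ (ℕP.<⇒≤ c<[1+m][1+n]))) (ℤ.+<+ (ℕP.m<n⇒0<n∸m c<[1+m][1+n]))
  where
  c<[1+m][1+n] : suc c ℕ.< suc m ℕ.* suc n
  c<[1+m][1+n] = ℕP.≤-trans (s≤s ∣c∣≤m) (ℕP.m≤m*n (suc m) (suc n))

m⊓[1+n]≡0⇒m≡0 : ∀ m n → m ⊓ suc n ≡ 0 → m ≡ 0
m⊓[1+n]≡0⇒m≡0 zero    n _ = refl

toℚ≡mkℚ : ∀ z → toℚ z ≡ mkℚ z 0 (coprime-sym (1-coprimeTo ∣ z ∣))
toℚ≡mkℚ z = ℚP.↥p/↧p≡p (mkℚ z 0 (coprime-sym (1-coprimeTo ∣ z ∣)))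

toℚ-homo-+ : ∀ a b → toℚ (a ℤ.+ b) ≡ toℚ a ℚ.+ toℚ b
toℚ-homo-+ a b = begin
  toℚ (a ℤ.+ b)                       ≡⟨ cong toℚ (cong₂ ℤ._+_ (ℤP.*-identityʳ a) (ℤP.*-identityʳ b)) ⟨
  toℚ (a ℤ.* + 1 ℤ.+ b ℤ.* + 1)       ≡⟨ cong₂ ℚ._+_ (toℚ≡mkℚ a) (toℚ≡mkℚ b) ⟨
  toℚ a ℚ.+ toℚ b                     ∎
  where open ≡-Reasoning

toℚ-homo-* : ∀ a b → toℚ (a ℤ.* b) ≡ toℚ a ℚ.* toℚ b
toℚ-homo-* a b = sym (cong₂ ℚ._*_ (toℚ≡mkℚ a) (toℚ≡mkℚ b))

toℚ-homo-neg : ∀ a → toℚ (ℤ.- a) ≡ ℚ.- toℚ a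
toℚ-homo-neg a = begin
  toℚ (ℤ.- a)                          ≡⟨ cancel (toℚ (ℤ.- a)) (toℚ a) ⟩
  (toℚ (ℤ.- a) ℚ.+ toℚ a) ℚ.- toℚ a    ≡⟨ cong (ℚ._- toℚ a) (toℚ-homo-+ (ℤ.- a) a) ⟨
  toℚ (ℤ.- a ℤ.+ a) ℚ.- toℚ a          ≡⟨ cong (λ z → toℚ z ℚ.- toℚ a) (ℤP.+-inverseˡ a) ⟩
  0ℚ ℚ.- toℚ a                         ≡⟨ ℚP.+-identityˡ _ ⟩
  ℚ.- toℚ a                            ∎
  where
  open ≡-Reasoning
  cancel : ∀ x y → x ≡ (x ℚ.+ y) ℚ.- y
  cancel = solve-∀ ℚ-ring

toℚ-homo-sub : ∀ a b → toℚ (a ℤ.- b) ≡ toℚ a ℚ.- toℚ b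
toℚ-homo-sub a b = trans (toℚ-homo-+ a (ℤ.- b)) (cong (toℚ a ℚ.+_) (toℚ-homo-neg b))

toℚ-suc : ∀ i → toℚ (+ suc i) ≡ 1ℚ ℚ.+ toℚ (+ i)
toℚ-suc i = toℚ-homo-+ (+ 1) (+ i)

toℚ-mono-< : ∀ {a b} → a ℤ.< b → toℚ a ℚ.< toℚ b
toℚ-mono-< {a} {b} a<b = subst₂ ℚ._<_ (sym (toℚ≡mkℚ a)) (sym (toℚ≡mkℚ b))
  (ℚ.*<* (subst₂ ℤ._<_ (sym (ℤP.*-identityʳ a)) (sym (ℤP.*-identityʳ b)) a<b))

toℚ-mono-≤ : ∀ {a b} → a ℤ.≤ b → toℚ a ℚ.≤ toℚ b
toℚ-mono-≤ {a} {b} a≤b = subst₂ ℚ._≤_ (sym (toℚ≡mkℚ a)) (sym (toℚ≡mkℚ b))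
  (ℚ.*≤* (subst₂ ℤ._≤_ (sym (ℤP.*-identityʳ a)) (sym (ℤP.*-identityʳ b)) a≤b))

0≤toℚ[+n] : ∀ n → 0ℚ ℚ.≤ toℚ (+ n)
0≤toℚ[+n] n = toℚ-mono-≤ {+ 0} {+ n} (ℤ.+≤+ z≤n)

0≤[n]-[k] : ∀ {k n} → k ℕ.≤ n → 0ℚ ℚ.≤ toℚ (+ n) ℚ.- toℚ (+ k)
0≤[n]-[k] {k} k≤n =
  let o , n≡k+o = m≤n⇒∃[o]n≡m+o k≤n
  in subst (λ n → 0ℚ ℚ.≤ toℚ (+ n) ℚ.- toℚ (+ k)) (sym n≡k+o)
       (subst (0ℚ ℚ.≤_) (sym (trans (cong (ℚ._- toℚ (+ k)) (toℚ-homo-+ (+ k) (+ o))) (cancel (toℚ (+ k)) (toℚ (+ o))))) (0≤toℚ[+n] o))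
  where
  cancel : ∀ a b → (a ℚ.+ b) ℚ.- a ≡ b
  cancel = solve-∀ ℚ-ring

1/[1+_] : ℕ → ℚ
1/[1+ k ] = mkℚ (+ 1) k (1-coprimeTo (suc k))

0<1/[1+k] : ∀ k → 0ℚ ℚ.< 1/[1+ k ]
0<1/[1+k] k = ℚP.positive⁻¹ 1/[1+ k ]

[1+k]*1/[1+k]≡1 : ∀ k → toℚ (+ suc k) ℚ.* 1/[1+ k ] ≡ 1ℚ
[1+k]*1/[1+k]≡1 k = trans (cong (ℚ._* 1/[1+ k ]) (toℚ≡mkℚ (+ suc k)))
  (ℚP.*-inverseʳ (mkℚ (+ suc k) 0 (coprime-sym (1-coprimeTo (suc k)))))

0≤-+ : ∀ {a b} → 0ℚ ℚ.≤ a → 0ℚ ℚ.≤ b → 0ℚ ℚ.≤ a ℚ.+ b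
0≤-+ {a} {b} 0≤a 0≤b = subst (ℚ._≤ a ℚ.+ b) (ℚP.+-identityˡ 0ℚ) (ℚP.+-mono-≤ 0≤a 0≤b)

0≤-* : ∀ {a b} → 0ℚ ℚ.≤ a → 0ℚ ℚ.≤ b → 0ℚ ℚ.≤ a ℚ.* b
0≤-* {a} {b} 0≤a 0≤b = ℚP.nonNegative⁻¹ _ {{ℚP.nonNeg*nonNeg⇒nonNeg a {{ℚ.nonNegative 0≤a}} b {{ℚ.nonNegative 0≤b}}}}

0<-+ : ∀ {a b} → 0ℚ ℚ.< a → 0ℚ ℚ.≤ b → 0ℚ ℚ.< a ℚ.+ b
0<-+ {a} {b} 0<a 0≤b = subst (ℚ._< a ℚ.+ b) (ℚP.+-identityˡ 0ℚ) (ℚP.+-mono-<-≤ 0<a 0≤b)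

0<-* : ∀ {a b} → 0ℚ ℚ.< a → 0ℚ ℚ.< b → 0ℚ ℚ.< a ℚ.* b
0<-* {a} {b} 0<a 0<b = ℚP.positive⁻¹ _ {{ℚP.pos*pos⇒pos a {{ℚ.positive 0<a}} b {{ℚ.positive 0<b}}}}

-- Affine functions on convex hulls

toPtℚ : Pt → Ptℚ
toPtℚ (x , y) = toℚ x , toℚ y

Affine : (Ptℚ → ℚ) → Set
Affine F = Σ[ a ∈ ℚ ] Σ[ b ∈ ℚ ] Σ[ c ∈ ℚ ] (∀ x y → F (x , y) ≡ a ℚ.* x ℚ.+ b ℚ.* y ℚ.+ c)

affine-combination : ∀ {F G} → Affine F → Affine G → ∀ α β γ →
  Affine (λ z → α ℚ.* F z ℚ.+ β ℚ.* G z ℚ.+ γ)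
affine-combination (a , b , c , hF) (a′ , b′ , c′ , hG) α β γ =
  α ℚ.* a ℚ.+ β ℚ.* a′ , α ℚ.* b ℚ.+ β ℚ.* b′ , α ℚ.* c ℚ.+ β ℚ.* c′ ℚ.+ γ ,
  λ x y → trans (cong₂ (λ u v → α ℚ.* u ℚ.+ β ℚ.* v ℚ.+ γ) (hF x y) (hG x y)) (collect α β γ a b c a′ b′ c′ x y)
  where
  collect : ∀ α β γ a b c a′ b′ c′ x y →
    α ℚ.* (a ℚ.* x ℚ.+ b ℚ.* y ℚ.+ c) ℚ.+ β ℚ.* (a′ ℚ.* x ℚ.+ b′ ℚ.* y ℚ.+ c′) ℚ.+ γ
    ≡ (α ℚ.* a ℚ.+ β ℚ.* a′) ℚ.* x ℚ.+ (α ℚ.* b ℚ.+ β ℚ.* b′) ℚ.* y ℚ.+ (α ℚ.* c ℚ.+ β ℚ.* c′ ℚ.+ γ)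
  collect = solve-∀ ℚ-ring

Affine-≗ : ∀ {F G} → Affine F → (∀ x → F x ≡ G x) → Affine G
Affine-≗ (a , b , c , hF) F≗G = a , b , c , λ x y → trans (sym (F≗G (x , y))) (hF x y)

weightedSum : (ps : List Pt) → (Fin (length ps) → ℚ) → (Ptℚ → ℚ) → ℚ
weightedSum []       w F = 0ℚ
weightedSum (z ∷ ps) w F = w zero ℚ.* F (toPtℚ z) ℚ.+ weightedSum ps (w ∘ suc) F

weightedSum-affine : ∀ {F} a b c → (∀ x y → F (x , y) ≡ a ℚ.* x ℚ.+ b ℚ.* y ℚ.+ c) → ∀ ps w →
  weightedSum ps w F ≡ a ℚ.* combX ps w ℚ.+ b ℚ.* combY ps w ℚ.+ c ℚ.* sumF w
weightedSum-affine a b c hF []       w = empty a b c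
  where
  empty : ∀ a b c → 0ℚ ≡ a ℚ.* 0ℚ ℚ.+ b ℚ.* 0ℚ ℚ.+ c ℚ.* 0ℚ
  empty = solve-∀ ℚ-ring
weightedSum-affine a b c hF (z ∷ ps) w =
  trans (cong₂ (λ u v → w zero ℚ.* u ℚ.+ v) (hF _ _) (weightedSum-affine a b c hF ps (w ∘ suc)))
        (distribute a b c (w zero) _ _ (combX ps (w ∘ suc)) (combY ps (w ∘ suc)) (sumF (w ∘ suc)))
  where
  distribute : ∀ a b c w₀ x y X Y W →
    w₀ ℚ.* (a ℚ.* x ℚ.+ b ℚ.* y ℚ.+ c) ℚ.+ (a ℚ.* X ℚ.+ b ℚ.* Y ℚ.+ c ℚ.* W)
    ≡ a ℚ.* (w₀ ℚ.* x ℚ.+ X) ℚ.+ b ℚ.* (w₀ ℚ.* y ℚ.+ Y) ℚ.+ c ℚ.* (w₀ ℚ.+ W)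
  distribute = solve-∀ ℚ-ring

weightedSum-nonneg : ∀ {F} ps w → (∀ i → 0ℚ ℚ.≤ w i) → (∀ {z} → z ∈L ps → 0ℚ ℚ.≤ F (toPtℚ z)) →
  0ℚ ℚ.≤ weightedSum ps w F
weightedSum-nonneg []       w 0≤w 0≤F = ℚP.≤-refl
weightedSum-nonneg (z ∷ ps) w 0≤w 0≤F =
  0≤-+ (0≤-* (0≤w zero) (0≤F (here refl))) (weightedSum-nonneg ps (w ∘ suc) (0≤w ∘ suc) (0≤F ∘ there))

affine-nonneg-on-hull : ∀ {F ps x} → Affine F → (∀ {z} → z ∈L ps → 0ℚ ℚ.≤ F (toPtℚ z)) →
  InConv ps x → 0ℚ ℚ.≤ F x
affine-nonneg-on-hull {F} {ps} {x , y} (a , b , c , hF) 0≤F (w , 0≤w , Σw≡1 , wx≡x , wy≡y) =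
  subst (0ℚ ℚ.≤_) (sym F[x,y]≡Σ) (weightedSum-nonneg ps w 0≤w 0≤F)
  where
  F[x,y]≡Σ : F (x , y) ≡ weightedSum ps w F
  F[x,y]≡Σ = begin
    F (x , y)                                                    ≡⟨ hF x y ⟩
    a ℚ.* x ℚ.+ b ℚ.* y ℚ.+ c                                    ≡⟨ cong (a ℚ.* x ℚ.+ b ℚ.* y ℚ.+_) (ℚP.*-identityʳ c) ⟨
    a ℚ.* x ℚ.+ b ℚ.* y ℚ.+ c ℚ.* 1ℚ                             ≡⟨ cong₃ (λ X Y W → a ℚ.* X ℚ.+ b ℚ.* Y ℚ.+ c ℚ.* W) wx≡x wy≡y Σw≡1 ⟨
    a ℚ.* combX ps w ℚ.+ b ℚ.* combY ps w ℚ.+ c ℚ.* sumF w       ≡⟨ weightedSum-affine a b c hF ps w ⟨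
    weightedSum ps w F                                           ∎
    where open ≡-Reasoning

weights₃ : ℚ → ℚ → ℚ → Fin 3 → ℚ
weights₃ a b c zero             = a
weights₃ a b c (suc zero)       = b
weights₃ a b c (suc (suc zero)) = c

weights₃-∀ : ∀ {P : ℚ → Set} {a b c} → P a → P b → P c → ∀ k → P (weights₃ a b c k)
weights₃-∀ pa pb pc zero             = pa
weights₃-∀ pa pb pc (suc zero)       = pb
weights₃-∀ pa pb pc (suc (suc zero)) = pc

orientation : Pt → Pt → Pt → ℤ
orientation a b w = det (b -ᵖ a) (w -ᵖ a)

data VertexPerm : Tri → Tri → Set where
  done   : ∀ {T} → VertexPerm T T
  swap₀₁ : ∀ {a b c T} → VertexPerm (b , a , c) T → VertexPerm (a , b , c) T
  swap₁₂ : ∀ {a b c T} → VertexPerm (a , c , b) T → VertexPerm (a , b , c) T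

private
  det-swap₀₁ : ∀ a₁ a₂ b₁ b₂ c₁ c₂ → (a₁ ℤ.- b₁) ℤ.* (c₂ ℤ.- b₂) ℤ.- (a₂ ℤ.- b₂) ℤ.* (c₁ ℤ.- b₁)
    ≡ ℤ.- ((b₁ ℤ.- a₁) ℤ.* (c₂ ℤ.- a₂) ℤ.- (b₂ ℤ.- a₂) ℤ.* (c₁ ℤ.- a₁))
  det-swap₀₁ = ℤ-Solver.solve-∀
  det-swap₁₂ : ∀ a₁ a₂ b₁ b₂ c₁ c₂ → (c₁ ℤ.- a₁) ℤ.* (b₂ ℤ.- a₂) ℤ.- (c₂ ℤ.- a₂) ℤ.* (b₁ ℤ.- a₁)
    ≡ ℤ.- ((b₁ ℤ.- a₁) ℤ.* (c₂ ℤ.- a₂) ℤ.- (b₂ ℤ.- a₂) ℤ.* (c₁ ℤ.- a₁))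
  det-swap₁₂ = ℤ-Solver.solve-∀

Unimodular-perm : ∀ {T T′} → VertexPerm T T′ → Unimodular T → Unimodular T′
Unimodular-perm done u = u
Unimodular-perm (swap₀₁ {a₁ , a₂} {b₁ , b₂} {c₁ , c₂} π) u =
  Unimodular-perm π (trans (cong ∣_∣ (det-swap₀₁ a₁ a₂ b₁ b₂ c₁ c₂))
    (trans (ℤP.∣-i∣≡∣i∣ (orientation (a₁ , a₂) (b₁ , b₂) (c₁ , c₂))) u))
Unimodular-perm (swap₁₂ {a₁ , a₂} {b₁ , b₂} {c₁ , c₂} π) u =
  Unimodular-perm π (trans (cong ∣_∣ (det-swap₁₂ a₁ a₂ b₁ b₂ c₁ c₂))
    (trans (ℤP.∣-i∣≡∣i∣ (orientation (a₁ , a₂) (b₁ , b₂) (c₁ , c₂))) u))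

private
  sum-swap₀₁ : ∀ w₀ w₁ w₂ → w₁ ℚ.+ (w₀ ℚ.+ (w₂ ℚ.+ 0ℚ)) ≡ w₀ ℚ.+ (w₁ ℚ.+ (w₂ ℚ.+ 0ℚ))
  sum-swap₀₁ = solve-∀ ℚ-ring
  comb-swap₀₁ : ∀ w₀ w₁ w₂ a b c → w₁ ℚ.* a ℚ.+ (w₀ ℚ.* b ℚ.+ (w₂ ℚ.* c ℚ.+ 0ℚ)) ≡ w₀ ℚ.* b ℚ.+ (w₁ ℚ.* a ℚ.+ (w₂ ℚ.* c ℚ.+ 0ℚ))
  comb-swap₀₁ = solve-∀ ℚ-ring
  sum-swap₁₂ : ∀ w₀ w₁ w₂ → w₀ ℚ.+ (w₂ ℚ.+ (w₁ ℚ.+ 0ℚ)) ≡ w₀ ℚ.+ (w₁ ℚ.+ (w₂ ℚ.+ 0ℚ))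
  sum-swap₁₂ = solve-∀ ℚ-ring
  comb-swap₁₂ : ∀ w₀ w₁ w₂ a b c → w₀ ℚ.* a ℚ.+ (w₂ ℚ.* b ℚ.+ (w₁ ℚ.* c ℚ.+ 0ℚ)) ≡ w₀ ℚ.* a ℚ.+ (w₁ ℚ.* c ℚ.+ (w₂ ℚ.* b ℚ.+ 0ℚ))
  comb-swap₁₂ = solve-∀ ℚ-ring

InRelInt-perm : ∀ {T T′ x} → VertexPerm T T′ → InRelInt (verts T′) x → InRelInt (verts T) x
InRelInt-perm done h = h
InRelInt-perm (swap₀₁ π) h with InRelInt-perm π h
... | w , 0<w , Σw , wx , wy = weights₃ w₁ w₀ w₂ , weights₃-∀ {ℚ._<_ 0ℚ} (0<w (suc zero)) (0<w zero) (0<w (suc (suc zero))) ,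
  trans (sum-swap₀₁ w₀ w₁ w₂) Σw , trans (comb-swap₀₁ w₀ w₁ w₂ _ _ _) wx , trans (comb-swap₀₁ w₀ w₁ w₂ _ _ _) wy
  where w₀ = w zero ; w₁ = w (suc zero) ; w₂ = w (suc (suc zero))
InRelInt-perm (swap₁₂ π) h with InRelInt-perm π h
... | w , 0<w , Σw , wx , wy = weights₃ w₀ w₂ w₁ , weights₃-∀ {ℚ._<_ 0ℚ} (0<w zero) (0<w (suc (suc zero))) (0<w (suc zero)) ,
  trans (sum-swap₁₂ w₀ w₁ w₂) Σw , trans (comb-swap₁₂ w₀ w₁ w₂ _ _ _) wx , trans (comb-swap₁₂ w₀ w₁ w₂ _ _ _) wy
  where w₀ = w zero ; w₁ = w (suc zero) ; w₂ = w (suc (suc zero))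

edge-first : ∀ {a b} T → a ∈V T → b ∈V T → a ≢ b → Σ[ c ∈ Pt ] VertexPerm T (a , b , c)
edge-first (t₀ , t₁ , t₂) (inj₁ refl)        (inj₁ refl)        a≢b = ⊥-elim (a≢b refl)
edge-first (t₀ , t₁ , t₂) (inj₁ refl)        (inj₂ (inj₁ refl)) a≢b = t₂ , done
edge-first (t₀ , t₁ , t₂) (inj₁ refl)        (inj₂ (inj₂ refl)) a≢b = t₁ , swap₁₂ done
edge-first (t₀ , t₁ , t₂) (inj₂ (inj₁ refl)) (inj₁ refl)        a≢b = t₂ , swap₀₁ done
edge-first (t₀ , t₁ , t₂) (inj₂ (inj₁ refl)) (inj₂ (inj₁ refl)) a≢b = ⊥-elim (a≢b refl)
edge-first (t₀ , t₁ , t₂) (inj₂ (inj₁ refl)) (inj₂ (inj₂ refl)) a≢b = t₀ , swap₀₁ (swap₁₂ done)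
edge-first (t₀ , t₁ , t₂) (inj₂ (inj₂ refl)) (inj₁ refl)        a≢b = t₁ , swap₁₂ (swap₀₁ done)
edge-first (t₀ , t₁ , t₂) (inj₂ (inj₂ refl)) (inj₂ (inj₁ refl)) a≢b = t₀ , swap₁₂ (swap₀₁ (swap₁₂ done))
edge-first (t₀ , t₁ , t₂) (inj₂ (inj₂ refl)) (inj₂ (inj₂ refl)) a≢b = ⊥-elim (a≢b refl)

vertex : Tri → Fin 3 → Pt
vertex (a , b , c) zero             = a
vertex (a , b , c) (suc zero)       = b
vertex (a , b , c) (suc (suc zero)) = c

vertexIndex : ∀ {v} T → v ∈V T → Fin 3
vertexIndex T (inj₁ _)        = zero
vertexIndex T (inj₂ (inj₁ _)) = suc zero
vertexIndex T (inj₂ (inj₂ _)) = suc (suc zero)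

vertex-vertexIndex : ∀ {v} T (v∈T : v ∈V T) → vertex T (vertexIndex T v∈T) ≡ v
vertex-vertexIndex (a , b , c) (inj₁ refl)        = refl
vertex-vertexIndex (a , b , c) (inj₂ (inj₁ refl)) = refl
vertex-vertexIndex (a , b , c) (inj₂ (inj₂ refl)) = refl

no-four-distinct-vertices : ∀ {a b c d} T → a ∈V T → b ∈V T → c ∈V T → d ∈V T →
  a ≢ b → a ≢ c → a ≢ d → b ≢ c → b ≢ d → c ≢ d → ⊥
no-four-distinct-vertices {a} {b} {c} {d} T a∈T b∈T c∈T d∈T a≢b a≢c a≢d b≢c b≢d c≢d
  = collision (FinP.pigeonhole (ℕP.n<1+n 3) (λ k → vertexIndex T (∈T k)))
  where
  xs : Fin 4 → Pt
  xs zero                   = a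
  xs (suc zero)             = b
  xs (suc (suc zero))       = c
  xs (suc (suc (suc zero))) = d
  ∈T : ∀ k → xs k ∈V T
  ∈T zero                   = a∈T
  ∈T (suc zero)             = b∈T
  ∈T (suc (suc zero))       = c∈T
  ∈T (suc (suc (suc zero))) = d∈T
  distinct : ∀ {k l} → k Fin.< l → xs k ≢ xs l
  distinct {zero}           {suc zero}             _ = a≢b
  distinct {zero}           {suc (suc zero)}       _ = a≢c
  distinct {zero}           {suc (suc (suc zero))} _ = a≢d
  distinct {suc zero}       {suc (suc zero)}       _ = b≢c
  distinct {suc zero}       {suc (suc (suc zero))} _ = b≢d
  distinct {suc (suc zero)} {suc (suc (suc zero))} _ = c≢d
  distinct {_}              {zero}                 ()
  distinct {suc zero}       {suc zero}             (s≤s ())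
  distinct {suc (suc _)}    {suc zero}             (s≤s ())
  distinct {suc (suc zero)} {suc (suc zero)}       (s≤s (s≤s ()))
  distinct {suc (suc (suc _))} {suc (suc zero)}    (s≤s (s≤s ()))
  distinct {suc (suc (suc zero))} {suc (suc (suc zero))} (s≤s (s≤s (s≤s ())))
  collision : (∃₂ λ k l → k Fin.< l × vertexIndex T (∈T k) ≡ vertexIndex T (∈T l)) → ⊥
  collision (k , l , k<l , same) = distinct k<l
    (trans (sym (vertex-vertexIndex T (∈T k))) (trans (cong (vertex T) same) (vertex-vertexIndex T (∈T l))))

infix 25 _*ᵖ_
_*ᵖ_ : ℤ → Pt → Pt
k *ᵖ (a , b) = (k ℤ.* a , k ℤ.* b)

_/[1+_]ᵖ : Pt → ℕ → Ptℚ
(x , y) /[1+ k ]ᵖ = toℚ x ℚ.* 1/[1+ k ] , toℚ y ℚ.* 1/[1+ k ]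

private
  toℚ-homo-lincomb₃ : ∀ a b c x y z →
    toℚ (a ℤ.* x ℤ.+ b ℤ.* y ℤ.+ c ℤ.* z) ≡ toℚ a ℚ.* toℚ x ℚ.+ toℚ b ℚ.* toℚ y ℚ.+ toℚ c ℚ.* toℚ z
  toℚ-homo-lincomb₃ a b c x y z = begin
    toℚ (a ℤ.* x ℤ.+ b ℤ.* y ℤ.+ c ℤ.* z)                   ≡⟨ toℚ-homo-+ (a ℤ.* x ℤ.+ b ℤ.* y) (c ℤ.* z) ⟩
    toℚ (a ℤ.* x ℤ.+ b ℤ.* y) ℚ.+ toℚ (c ℤ.* z)             ≡⟨ cong (ℚ._+ toℚ (c ℤ.* z)) (toℚ-homo-+ (a ℤ.* x) (b ℤ.* y)) ⟩
    toℚ (a ℤ.* x) ℚ.+ toℚ (b ℤ.* y) ℚ.+ toℚ (c ℤ.* z)       ≡⟨ cong₃ (λ u v w → u ℚ.+ v ℚ.+ w) (toℚ-homo-* a x) (toℚ-homo-* b y) (toℚ-homo-* c z) ⟩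
    toℚ a ℚ.* toℚ x ℚ.+ toℚ b ℚ.* toℚ y ℚ.+ toℚ c ℚ.* toℚ z ∎
    where open ≡-Reasoning
  scale-sum₃ : ∀ a b c k → a ℚ.* k ℚ.+ (b ℚ.* k ℚ.+ (c ℚ.* k ℚ.+ 0ℚ)) ≡ (a ℚ.* 1ℚ ℚ.+ b ℚ.* 1ℚ ℚ.+ c ℚ.* 1ℚ) ℚ.* k
  scale-sum₃ = solve-∀ ℚ-ring
  scale-comb₃ : ∀ a b c k x y z → a ℚ.* k ℚ.* x ℚ.+ (b ℚ.* k ℚ.* y ℚ.+ (c ℚ.* k ℚ.* z ℚ.+ 0ℚ)) ≡ (a ℚ.* x ℚ.+ b ℚ.* y ℚ.+ c ℚ.* z) ℚ.* k
  scale-comb₃ = solve-∀ ℚ-ring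

positive-weights⇒InRelInt : ∀ (a b c : Pt) {W₀ W₁ W₂ : ℤ} k → + 0 ℤ.< W₀ → + 0 ℤ.< W₁ → + 0 ℤ.< W₂ →
  W₀ ℤ.+ W₁ ℤ.+ W₂ ≡ + suc k → InRelInt (a ∷ b ∷ c ∷ []) ((((W₀ *ᵖ a) +ᵖ (W₁ *ᵖ b)) +ᵖ (W₂ *ᵖ c)) /[1+ k ]ᵖ)
positive-weights⇒InRelInt a b c {W₀} {W₁} {W₂} k 0<W₀ 0<W₁ 0<W₂ ΣW≡1+k =
  weights₃ (w W₀) (w W₁) (w W₂) ,
  weights₃-∀ {ℚ._<_ 0ℚ} (0<w 0<W₀) (0<w 0<W₁) (0<w 0<W₂) ,
  trans (scale-sum₃ (toℚ W₀) (toℚ W₁) (toℚ W₂) 1/[1+ k ])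
        (trans (cong (ℚ._* 1/[1+ k ]) (trans (sym (toℚ-homo-lincomb₃ W₀ W₁ W₂ (+ 1) (+ 1) (+ 1))) (cong toℚ ΣW)))
               ([1+k]*1/[1+k]≡1 k)) ,
  trans (scale-comb₃ (toℚ W₀) (toℚ W₁) (toℚ W₂) 1/[1+ k ] _ _ _) (cong (ℚ._* 1/[1+ k ]) (sym (toℚ-homo-lincomb₃ W₀ W₁ W₂ _ _ _))) ,
  trans (scale-comb₃ (toℚ W₀) (toℚ W₁) (toℚ W₂) 1/[1+ k ] _ _ _) (cong (ℚ._* 1/[1+ k ]) (sym (toℚ-homo-lincomb₃ W₀ W₁ W₂ _ _ _)))
  where
  w : ℤ → ℚ
  w W = toℚ W ℚ.* 1/[1+ k ]
  0<w : ∀ {W} → + 0 ℤ.< W → 0ℚ ℚ.< w W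
  0<w 0<W = 0<-* (toℚ-mono-< 0<W) (0<1/[1+k] k)
  ΣW : W₀ ℤ.* + 1 ℤ.+ W₁ ℤ.* + 1 ℤ.+ W₂ ℤ.* + 1 ≡ + suc k
  ΣW = trans (cong₃ (λ x y z → x ℤ.+ y ℤ.+ z) (ℤP.*-identityʳ W₀) (ℤP.*-identityʳ W₁) (ℤP.*-identityʳ W₂)) ΣW≡1+k

edgeCoord apexCoord : Pt → Pt → Pt → Pt → ℤ
edgeCoord a b w δ = orientation a b w ℤ.* det δ (w -ᵖ a)
apexCoord a b w δ = orientation a b w ℤ.* det (b -ᵖ a) δ

private
  cramer : ∀ σ N T₁ T₂ a₁ a₂ b₁ b₂ w₁ w₂ δ₁ δ₂ →
    (N ℤ.* T₁ ℤ.- (σ ℤ.* (δ₁ ℤ.* (w₂ ℤ.- a₂) ℤ.- δ₂ ℤ.* (w₁ ℤ.- a₁)) ℤ.+ σ ℤ.* ((b₁ ℤ.- a₁) ℤ.* δ₂ ℤ.- (b₂ ℤ.- a₂) ℤ.* δ₁))) ℤ.* a₁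
    ℤ.+ (N ℤ.* T₂ ℤ.+ σ ℤ.* (δ₁ ℤ.* (w₂ ℤ.- a₂) ℤ.- δ₂ ℤ.* (w₁ ℤ.- a₁))) ℤ.* b₁
    ℤ.+ σ ℤ.* ((b₁ ℤ.- a₁) ℤ.* δ₂ ℤ.- (b₂ ℤ.- a₂) ℤ.* δ₁) ℤ.* w₁
    ≡ N ℤ.* (T₁ ℤ.* a₁ ℤ.+ T₂ ℤ.* b₁) ℤ.+ σ ℤ.* ((b₁ ℤ.- a₁) ℤ.* (w₂ ℤ.- a₂) ℤ.- (b₂ ℤ.- a₂) ℤ.* (w₁ ℤ.- a₁)) ℤ.* δ₁
  cramer = ℤ-Solver.solve-∀
  cramer′ : ∀ σ N T₁ T₂ a₁ a₂ b₁ b₂ w₁ w₂ δ₁ δ₂ →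
    (N ℤ.* T₁ ℤ.- (σ ℤ.* (δ₁ ℤ.* (w₂ ℤ.- a₂) ℤ.- δ₂ ℤ.* (w₁ ℤ.- a₁)) ℤ.+ σ ℤ.* ((b₁ ℤ.- a₁) ℤ.* δ₂ ℤ.- (b₂ ℤ.- a₂) ℤ.* δ₁))) ℤ.* a₂
    ℤ.+ (N ℤ.* T₂ ℤ.+ σ ℤ.* (δ₁ ℤ.* (w₂ ℤ.- a₂) ℤ.- δ₂ ℤ.* (w₁ ℤ.- a₁))) ℤ.* b₂
    ℤ.+ σ ℤ.* ((b₁ ℤ.- a₁) ℤ.* δ₂ ℤ.- (b₂ ℤ.- a₂) ℤ.* δ₁) ℤ.* w₂
    ≡ N ℤ.* (T₁ ℤ.* a₂ ℤ.+ T₂ ℤ.* b₂) ℤ.+ σ ℤ.* ((b₁ ℤ.- a₁) ℤ.* (w₂ ℤ.- a₂) ℤ.- (b₂ ℤ.- a₂) ℤ.* (w₁ ℤ.- a₁)) ℤ.* δ₂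
  cramer′ = ℤ-Solver.solve-∀
  weights-sum : ∀ N T₁ T₂ c₁ c₂ → N ℤ.* T₁ ℤ.- (c₁ ℤ.+ c₂) ℤ.+ (N ℤ.* T₂ ℤ.+ c₁) ℤ.+ c₂ ≡ N ℤ.* (T₁ ℤ.+ T₂)
  weights-sum = ℤ-Solver.solve-∀

-- By Cramer's rule δ = c₁ (b − a) + c₂ (w − a) with c₁ = edgeCoord, c₂ = apexCoord (the orientation is ±1, its
-- own inverse), so N (T₁ a + T₂ b) + δ has the integer barycentric weights (N T₁ − c₁ − c₂ , N T₂ + c₁ , c₂).
near-edge-interior : ∀ (a b w δ : Pt) (N T₁ T₂ : ℤ) k → orientation a b w ℤ.* orientation a b w ≡ + 1 →
  + 0 ℤ.< N ℤ.* T₁ ℤ.- (edgeCoord a b w δ ℤ.+ apexCoord a b w δ) → + 0 ℤ.< N ℤ.* T₂ ℤ.+ edgeCoord a b w δ →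
  + 0 ℤ.< apexCoord a b w δ → N ℤ.* (T₁ ℤ.+ T₂) ≡ + suc k →
  InRelInt (a ∷ b ∷ w ∷ []) (((N *ᵖ ((T₁ *ᵖ a) +ᵖ (T₂ *ᵖ b))) +ᵖ δ) /[1+ k ]ᵖ)
near-edge-interior a@(a₁ , a₂) b@(b₁ , b₂) w@(w₁ , w₂) δ@(δ₁ , δ₂) N T₁ T₂ k σ²≡1 0<W₀ 0<W₁ 0<W₂ N[T₁+T₂]≡1+k =
  subst (InRelInt (a ∷ b ∷ w ∷ [])) (cong (_/[1+ k ]ᵖ) (cong₂ _,_
      (trans (cramer σ N T₁ T₂ a₁ a₂ b₁ b₂ w₁ w₂ δ₁ δ₂) (cong (ℤ._+_ (N ℤ.* (T₁ ℤ.* a₁ ℤ.+ T₂ ℤ.* b₁))) (σ²δ≡δ δ₁)))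
      (trans (cramer′ σ N T₁ T₂ a₁ a₂ b₁ b₂ w₁ w₂ δ₁ δ₂) (cong (ℤ._+_ (N ℤ.* (T₁ ℤ.* a₂ ℤ.+ T₂ ℤ.* b₂))) (σ²δ≡δ δ₂)))))
    (positive-weights⇒InRelInt a b w k 0<W₀ 0<W₁ 0<W₂
      (trans (weights-sum N T₁ T₂ (edgeCoord a b w δ) (apexCoord a b w δ)) N[T₁+T₂]≡1+k))
  where
  σ = orientation a b w
  σ²δ≡δ : ∀ z → σ ℤ.* σ ℤ.* z ≡ z
  σ²δ≡δ z = trans (cong (ℤ._* z) σ²≡1) (ℤP.*-identityˡ z)

module Counting {A : Set} {P : A → Set} (P? : (x : A) → Dec (P x)) (f : ℕ → A) where

  count : ℕ → ℕ
  count t = length (filter P? (map f (upTo t)))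

  count-suc : ∀ t → count (suc t) ≡ count t ℕ.+ length (filter P? (f t ∷ []))
  count-suc t = begin
    length (filter P? (map f (upTo (suc t))))                ≡⟨ cong (λ l → length (filter P? (map f l))) (ListP.upTo-∷ʳ t) ⟨
    length (filter P? (map f (upTo t ++ t ∷ [])))            ≡⟨ cong (length ∘ filter P?) (ListP.map-++ f (upTo t) (t ∷ [])) ⟩
    length (filter P? (map f (upTo t) ++ f t ∷ []))          ≡⟨ cong length (ListP.filter-++ P? (map f (upTo t)) (f t ∷ [])) ⟩
    length (filter P? (map f (upTo t)) ++ filter P? (f t ∷ [])) ≡⟨ ListP.length-++ (filter P? (map f (upTo t))) ⟩
    count t ℕ.+ length (filter P? (f t ∷ []))                ∎
    where open ≡-Reasoning

  count-suc-yes : ∀ t → P (f t) → count (suc t) ≡ suc (count t)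
  count-suc-yes t p = trans (count-suc t)
    (trans (cong (λ l → count t ℕ.+ length l) (ListP.filter-accept P? {xs = []} p)) (ℕP.+-comm (count t) 1))

  count-suc-no : ∀ t → ¬ P (f t) → count (suc t) ≡ count t
  count-suc-no t ¬p = trans (count-suc t)
    (trans (cong (λ l → count t ℕ.+ length l) (ListP.filter-reject P? {xs = []} ¬p)) (ℕP.+-identityʳ (count t)))

  count≤ : ∀ t → count t ℕ.≤ t
  count≤ t = ℕP.≤-trans (ListP.length-filter P? (map f (upTo t)))
    (ℕP.≤-reflexive (trans (ListP.length-map f (upTo t)) (ListP.length-upTo t)))

  count-mono-suc : ∀ t → count t ℕ.≤ count (suc t)
  count-mono-suc t with P? (f t)
  ... | yes p  = ℕP.≤-trans (ℕP.n≤1+n (count t)) (ℕP.≤-reflexive (sym (count-suc-yes t p)))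
  ... | no ¬p = ℕP.≤-reflexive (sym (count-suc-no t ¬p))

  count-mono : ∀ {t t′} → t ℕ.≤ t′ → count t ℕ.≤ count t′
  count-mono {t′ = zero}   z≤n = ℕP.≤-refl
  count-mono {t′ = suc t′} t≤1+t′ with ℕP.m≤n⇒m<n∨m≡n t≤1+t′
  ... | inj₁ t<1+t′ = ℕP.≤-trans (count-mono (ℕP.≤-pred t<1+t′)) (count-mono-suc t′)
  ... | inj₂ refl   = ℕP.≤-refl

  count-all : ∀ t → (∀ k → k ℕ.< t → P (f k)) → t ℕ.≤ count t
  count-all zero    all = z≤n
  count-all (suc t) all = subst (suc t ℕ.≤_) (sym (count-suc-yes t (all t ℕP.≤-refl)))
    (s≤s (count-all t (λ k k<t → all k (ℕP.m≤n⇒m≤1+n k<t))))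

  count-two⁺ : ∀ {a b t} → a ℕ.< b → b ℕ.< t → P (f a) → P (f b) → 2 ℕ.≤ count t
  count-two⁺ {a} {b} a<b b<t pa pb = ℕP.≤-trans 2≤count[1+b] (count-mono b<t)
    where
    1≤count[b] : 1 ℕ.≤ count b
    1≤count[b] = ℕP.≤-trans (subst (1 ℕ.≤_) (sym (count-suc-yes a pa)) (s≤s z≤n)) (count-mono a<b)
    2≤count[1+b] : 2 ℕ.≤ count (suc b)
    2≤count[1+b] = subst (2 ℕ.≤_) (sym (count-suc-yes b pb)) (s≤s 1≤count[b])

  count-one⁻ : ∀ t → 1 ℕ.≤ count t → ∃ λ a → a ℕ.< t × P (f a)
  count-one⁻ (suc t) 1≤c with P? (f t)
  ... | yes p  = t , ℕP.≤-refl , p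
  ... | no ¬p with count-one⁻ t (subst (1 ℕ.≤_) (count-suc-no t ¬p) 1≤c)
  ...   | a , a<t , pa = a , ℕP.m≤n⇒m≤1+n a<t , pa

  count-two⁻ : ∀ t → 2 ℕ.≤ count t → ∃₂ λ a b → a ℕ.< b × b ℕ.< t × P (f a) × P (f b)
  count-two⁻ (suc t) 2≤c with P? (f t)
  ... | yes p with count-one⁻ t (ℕP.≤-pred (subst (2 ℕ.≤_) (count-suc-yes t p) 2≤c))
  ...   | a , a<t , pa = a , t , a<t , ℕP.≤-refl , pa , p
  count-two⁻ (suc t) 2≤c | no ¬p with count-two⁻ t (subst (2 ℕ.≤_) (count-suc-no t ¬p) 2≤c)
  ...   | a , b , a<b , b<t , pa , pb = a , b , a<b , ℕP.m≤n⇒m≤1+n b<t , pa , pb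

-- Strip coordinates

module StripCoordinates (p q d : Pt) (∣s∣≡1 : ∣ det d (q -ᵖ p) ∣ ≡ 1) where

  e : Pt
  e = q -ᵖ p

  s : ℤ
  s = det d e

  s²≡1 : s ℤ.* s ≡ + 1
  s²≡1 = ∣i∣≡1⇒i*i≡1 s ∣s∣≡1

  -- z = p + U z · d + V z · e by Cramer's rule, as s = det d e is its own inverse.

  ν′ μ′ : ℕ → Pt
  ν′ = ν p d
  μ′ = ν q d

  U V : Pt → ℤ
  U z = s ℤ.* det (z -ᵖ p) e
  V z = s ℤ.* det d (z -ᵖ p)

  private
    U-ν′-expand : ∀ s p₁ p₂ d₁ d₂ e₁ e₂ i →
      s ℤ.* ((p₁ ℤ.+ i ℤ.* d₁ ℤ.- p₁) ℤ.* e₂ ℤ.- (p₂ ℤ.+ i ℤ.* d₂ ℤ.- p₂) ℤ.* e₁) ≡ i ℤ.* (s ℤ.* (d₁ ℤ.* e₂ ℤ.- d₂ ℤ.* e₁))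
    U-ν′-expand = ℤ-Solver.solve-∀
    V-ν′-expand : ∀ s p₁ p₂ d₁ d₂ i → s ℤ.* (d₁ ℤ.* (p₂ ℤ.+ i ℤ.* d₂ ℤ.- p₂) ℤ.- d₂ ℤ.* (p₁ ℤ.+ i ℤ.* d₁ ℤ.- p₁)) ≡ + 0
    V-ν′-expand = ℤ-Solver.solve-∀
    U-μ′-expand : ∀ s p₁ p₂ q₁ q₂ d₁ d₂ j →
      s ℤ.* ((q₁ ℤ.+ j ℤ.* d₁ ℤ.- p₁) ℤ.* (q₂ ℤ.- p₂) ℤ.- (q₂ ℤ.+ j ℤ.* d₂ ℤ.- p₂) ℤ.* (q₁ ℤ.- p₁))
      ≡ j ℤ.* (s ℤ.* (d₁ ℤ.* (q₂ ℤ.- p₂) ℤ.- d₂ ℤ.* (q₁ ℤ.- p₁)))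
    U-μ′-expand = ℤ-Solver.solve-∀
    V-μ′-expand : ∀ s p₁ p₂ q₁ q₂ d₁ d₂ j →
      s ℤ.* (d₁ ℤ.* (q₂ ℤ.+ j ℤ.* d₂ ℤ.- p₂) ℤ.- d₂ ℤ.* (q₁ ℤ.+ j ℤ.* d₁ ℤ.- p₁))
      ≡ s ℤ.* (d₁ ℤ.* (q₂ ℤ.- p₂) ℤ.- d₂ ℤ.* (q₁ ℤ.- p₁))
    V-μ′-expand = ℤ-Solver.solve-∀

  U-ν′ : ∀ i → U (ν′ i) ≡ + i
  U-ν′ i = trans (U-ν′-expand s (proj₁ p) (proj₂ p) (proj₁ d) (proj₂ d) (proj₁ e) (proj₂ e) (+ i))
    (trans (cong (+ i ℤ.*_) s²≡1) (ℤP.*-identityʳ (+ i)))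

  V-ν′ : ∀ i → V (ν′ i) ≡ + 0
  V-ν′ i = V-ν′-expand s (proj₁ p) (proj₂ p) (proj₁ d) (proj₂ d) (+ i)

  U-μ′ : ∀ j → U (μ′ j) ≡ + j
  U-μ′ j = trans (U-μ′-expand s (proj₁ p) (proj₂ p) (proj₁ q) (proj₂ q) (proj₁ d) (proj₂ d) (+ j))
    (trans (cong (+ j ℤ.*_) s²≡1) (ℤP.*-identityʳ (+ j)))

  V-μ′ : ∀ j → V (μ′ j) ≡ + 1
  V-μ′ j = trans (V-μ′-expand s (proj₁ p) (proj₂ p) (proj₁ q) (proj₂ q) (proj₁ d) (proj₂ d) (+ j)) s²≡1

  ν′≢μ′ : ∀ i j → ν′ i ≢ μ′ j
  ν′≢μ′ i j ν′i≡μ′j with trans (sym (V-ν′ i)) (trans (cong V ν′i≡μ′j) (V-μ′ j))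
  ... | ()

  ν′-injective : ∀ {i k} → ν′ i ≡ ν′ k → i ≡ k
  ν′-injective {i} {k} ν′i≡ν′k = ℤP.+-injective (trans (sym (U-ν′ i)) (trans (cong U ν′i≡ν′k) (U-ν′ k)))

  μ′-injective : ∀ {i k} → μ′ i ≡ μ′ k → i ≡ k
  μ′-injective {i} {k} μ′i≡μ′k = ℤP.+-injective (trans (sym (U-μ′ i)) (trans (cong U μ′i≡μ′k) (U-μ′ k)))

  P₁ P₂ D₁ D₂ E₁ E₂ S : ℚ
  P₁ = toℚ (proj₁ p)
  P₂ = toℚ (proj₂ p)
  D₁ = toℚ (proj₁ d)
  D₂ = toℚ (proj₂ d)
  E₁ = toℚ (proj₁ e)
  E₂ = toℚ (proj₂ e)
  S  = toℚ s

  fromUV : ℚ → ℚ → Ptℚ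
  fromUV u v = P₁ ℚ.+ u ℚ.* D₁ ℚ.+ v ℚ.* E₁ , P₂ ℚ.+ u ℚ.* D₂ ℚ.+ v ℚ.* E₂

  uℚ vℚ : Ptℚ → ℚ
  uℚ (x , y) = S ℚ.* ((x ℚ.- P₁) ℚ.* E₂ ℚ.- (y ℚ.- P₂) ℚ.* E₁)
  vℚ (x , y) = S ℚ.* (D₁ ℚ.* (y ℚ.- P₂) ℚ.- D₂ ℚ.* (x ℚ.- P₁))

  S*det≡1 : S ℚ.* (D₁ ℚ.* E₂ ℚ.- D₂ ℚ.* E₁) ≡ 1ℚ
  S*det≡1 = begin
    S ℚ.* (D₁ ℚ.* E₂ ℚ.- D₂ ℚ.* E₁)  ≡⟨ cong (S ℚ.*_) (cong₂ ℚ._-_ (toℚ-homo-* (proj₁ d) (proj₂ e)) (toℚ-homo-* (proj₂ d) (proj₁ e))) ⟨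
    S ℚ.* (toℚ (proj₁ d ℤ.* proj₂ e) ℚ.- toℚ (proj₂ d ℤ.* proj₁ e))
                                     ≡⟨ cong (S ℚ.*_) (toℚ-homo-sub (proj₁ d ℤ.* proj₂ e) (proj₂ d ℤ.* proj₁ e)) ⟨
    S ℚ.* S                          ≡⟨ toℚ-homo-* s s ⟨
    toℚ (s ℤ.* s)                    ≡⟨ cong toℚ s²≡1 ⟩
    1ℚ                               ∎
    where open ≡-Reasoning

  private
    u-inverse : ∀ S u v P₁ P₂ D₁ D₂ E₁ E₂ →
      S ℚ.* ((P₁ ℚ.+ u ℚ.* D₁ ℚ.+ v ℚ.* E₁ ℚ.- P₁) ℚ.* E₂ ℚ.- (P₂ ℚ.+ u ℚ.* D₂ ℚ.+ v ℚ.* E₂ ℚ.- P₂) ℚ.* E₁)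
      ≡ u ℚ.* (S ℚ.* (D₁ ℚ.* E₂ ℚ.- D₂ ℚ.* E₁))
    u-inverse = solve-∀ ℚ-ring
    v-inverse : ∀ S u v P₁ P₂ D₁ D₂ E₁ E₂ →
      S ℚ.* (D₁ ℚ.* (P₂ ℚ.+ u ℚ.* D₂ ℚ.+ v ℚ.* E₂ ℚ.- P₂) ℚ.- D₂ ℚ.* (P₁ ℚ.+ u ℚ.* D₁ ℚ.+ v ℚ.* E₁ ℚ.- P₁))
      ≡ v ℚ.* (S ℚ.* (D₁ ℚ.* E₂ ℚ.- D₂ ℚ.* E₁))
    v-inverse = solve-∀ ℚ-ring
    x-inverse : ∀ S x y P₁ P₂ D₁ D₂ E₁ E₂ →
      P₁ ℚ.+ (S ℚ.* ((x ℚ.- P₁) ℚ.* E₂ ℚ.- (y ℚ.- P₂) ℚ.* E₁)) ℚ.* D₁ ℚ.+ (S ℚ.* (D₁ ℚ.* (y ℚ.- P₂) ℚ.- D₂ ℚ.* (x ℚ.- P₁))) ℚ.* E₁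
      ≡ P₁ ℚ.+ (x ℚ.- P₁) ℚ.* (S ℚ.* (D₁ ℚ.* E₂ ℚ.- D₂ ℚ.* E₁))
    x-inverse = solve-∀ ℚ-ring
    y-inverse : ∀ S x y P₁ P₂ D₁ D₂ E₁ E₂ →
      P₂ ℚ.+ (S ℚ.* ((x ℚ.- P₁) ℚ.* E₂ ℚ.- (y ℚ.- P₂) ℚ.* E₁)) ℚ.* D₂ ℚ.+ (S ℚ.* (D₁ ℚ.* (y ℚ.- P₂) ℚ.- D₂ ℚ.* (x ℚ.- P₁))) ℚ.* E₂
      ≡ P₂ ℚ.+ (y ℚ.- P₂) ℚ.* (S ℚ.* (D₁ ℚ.* E₂ ℚ.- D₂ ℚ.* E₁))
    y-inverse = solve-∀ ℚ-ring
    shift-back : ∀ a x → a ℚ.+ (x ℚ.- a) ℚ.* 1ℚ ≡ x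
    shift-back = solve-∀ ℚ-ring

  uℚ-fromUV : ∀ u v → uℚ (fromUV u v) ≡ u
  uℚ-fromUV u v = trans (u-inverse S u v P₁ P₂ D₁ D₂ E₁ E₂) (trans (cong (u ℚ.*_) S*det≡1) (ℚP.*-identityʳ u))

  vℚ-fromUV : ∀ u v → vℚ (fromUV u v) ≡ v
  vℚ-fromUV u v = trans (v-inverse S u v P₁ P₂ D₁ D₂ E₁ E₂) (trans (cong (v ℚ.*_) S*det≡1) (ℚP.*-identityʳ v))

  fromUV-uℚ-vℚ : ∀ x → fromUV (uℚ x) (vℚ x) ≡ x
  fromUV-uℚ-vℚ (x , y) = cong₂ _,_
    (trans (x-inverse S x y P₁ P₂ D₁ D₂ E₁ E₂) (trans (cong (λ t → P₁ ℚ.+ (x ℚ.- P₁) ℚ.* t) S*det≡1) (shift-back P₁ x)))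
    (trans (y-inverse S x y P₁ P₂ D₁ D₂ E₁ E₂) (trans (cong (λ t → P₂ ℚ.+ (y ℚ.- P₂) ℚ.* t) S*det≡1) (shift-back P₂ y)))

  private
    toℚ-homo-line : ∀ a i b → toℚ (a ℤ.+ i ℤ.* b) ≡ toℚ a ℚ.+ toℚ i ℚ.* toℚ b
    toℚ-homo-line a i b = trans (toℚ-homo-+ a (i ℤ.* b)) (cong (toℚ a ℚ.+_) (toℚ-homo-* i b))
    on-τ : ∀ a b c e → a ℚ.+ b ℚ.* c ≡ a ℚ.+ b ℚ.* c ℚ.+ 0ℚ ℚ.* e
    on-τ = solve-∀ ℚ-ring
    on-τ′ : ∀ p q j d → q ℚ.+ j ℚ.* d ≡ p ℚ.+ j ℚ.* d ℚ.+ 1ℚ ℚ.* (q ℚ.- p)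
    on-τ′ = solve-∀ ℚ-ring

  toPtℚ-ν′ : ∀ i → toPtℚ (ν′ i) ≡ fromUV (toℚ (+ i)) 0ℚ
  toPtℚ-ν′ i = cong₂ _,_
    (trans (toℚ-homo-line (proj₁ p) (+ i) (proj₁ d)) (on-τ P₁ (toℚ (+ i)) D₁ E₁))
    (trans (toℚ-homo-line (proj₂ p) (+ i) (proj₂ d)) (on-τ P₂ (toℚ (+ i)) D₂ E₂))

  toPtℚ-μ′ : ∀ j → toPtℚ (μ′ j) ≡ fromUV (toℚ (+ j)) 1ℚ
  toPtℚ-μ′ j = cong₂ _,_
    (trans (toℚ-homo-line (proj₁ q) (+ j) (proj₁ d))
      (trans (on-τ′ P₁ (toℚ (proj₁ q)) (toℚ (+ j)) D₁) (cong (λ t → P₁ ℚ.+ toℚ (+ j) ℚ.* D₁ ℚ.+ 1ℚ ℚ.* t) (sym (toℚ-homo-sub (proj₁ q) (proj₁ p))))))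
    (trans (toℚ-homo-line (proj₂ q) (+ j) (proj₂ d))
      (trans (on-τ′ P₂ (toℚ (proj₂ q)) (toℚ (+ j)) D₂) (cong (λ t → P₂ ℚ.+ toℚ (+ j) ℚ.* D₂ ℚ.+ 1ℚ ℚ.* t) (sym (toℚ-homo-sub (proj₂ q) (proj₂ p))))))

  Affine-uℚ : Affine uℚ
  Affine-uℚ = S ℚ.* E₂ , ℚ.- (S ℚ.* E₁) , S ℚ.* (P₂ ℚ.* E₁ ℚ.- P₁ ℚ.* E₂) , λ x y → expand S x y P₁ P₂ E₁ E₂
    where
    expand : ∀ S x y P₁ P₂ E₁ E₂ → S ℚ.* ((x ℚ.- P₁) ℚ.* E₂ ℚ.- (y ℚ.- P₂) ℚ.* E₁)
      ≡ (S ℚ.* E₂) ℚ.* x ℚ.+ (ℚ.- (S ℚ.* E₁)) ℚ.* y ℚ.+ S ℚ.* (P₂ ℚ.* E₁ ℚ.- P₁ ℚ.* E₂)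
    expand = solve-∀ ℚ-ring

  Affine-vℚ : Affine vℚ
  Affine-vℚ = ℚ.- (S ℚ.* D₂) , S ℚ.* D₁ , S ℚ.* (D₂ ℚ.* P₁ ℚ.- D₁ ℚ.* P₂) , λ x y → expand S x y P₁ P₂ D₁ D₂
    where
    expand : ∀ S x y P₁ P₂ D₁ D₂ → S ℚ.* (D₁ ℚ.* (y ℚ.- P₂) ℚ.- D₂ ℚ.* (x ℚ.- P₁))
      ≡ (ℚ.- (S ℚ.* D₂)) ℚ.* x ℚ.+ (S ℚ.* D₁) ℚ.* y ℚ.+ S ℚ.* (D₂ ℚ.* P₁ ℚ.- D₁ ℚ.* P₂)
    expand = solve-∀ ℚ-ring

  uℚ-ν′ : ∀ k → uℚ (toPtℚ (ν′ k)) ≡ toℚ (+ k)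
  uℚ-ν′ k = trans (cong uℚ (toPtℚ-ν′ k)) (uℚ-fromUV (toℚ (+ k)) 0ℚ)

  vℚ-ν′ : ∀ k → vℚ (toPtℚ (ν′ k)) ≡ 0ℚ
  vℚ-ν′ k = trans (cong vℚ (toPtℚ-ν′ k)) (vℚ-fromUV (toℚ (+ k)) 0ℚ)

  uℚ-μ′ : ∀ k → uℚ (toPtℚ (μ′ k)) ≡ toℚ (+ k)
  uℚ-μ′ k = trans (cong uℚ (toPtℚ-μ′ k)) (uℚ-fromUV (toℚ (+ k)) 1ℚ)

  vℚ-μ′ : ∀ k → vℚ (toPtℚ (μ′ k)) ≡ 1ℚ
  vℚ-μ′ k = trans (cong vℚ (toPtℚ-μ′ k)) (vℚ-fromUV (toℚ (+ k)) 1ℚ)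

  private
    UV-expand : ∀ α β γ s e₁ e₂ d₁ d₂ p₁ p₂ z₁ z₂ →
      (α ℤ.* (s ℤ.* e₂) ℤ.+ β ℤ.* (ℤ.- (s ℤ.* d₂))) ℤ.* z₁ ℤ.+ (α ℤ.* (ℤ.- (s ℤ.* e₁)) ℤ.+ β ℤ.* (s ℤ.* d₁)) ℤ.* z₂
        ℤ.+ (α ℤ.* (s ℤ.* (p₂ ℤ.* e₁ ℤ.- p₁ ℤ.* e₂)) ℤ.+ β ℤ.* (s ℤ.* (d₂ ℤ.* p₁ ℤ.- d₁ ℤ.* p₂)) ℤ.+ γ)
      ≡ α ℤ.* (s ℤ.* ((z₁ ℤ.- p₁) ℤ.* e₂ ℤ.- (z₂ ℤ.- p₂) ℤ.* e₁)) ℤ.+ β ℤ.* (s ℤ.* (d₁ ℤ.* (z₂ ℤ.- p₂) ℤ.- d₂ ℤ.* (z₁ ℤ.- p₁))) ℤ.+ γ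
    UV-expand = ℤ-Solver.solve-∀

  UV-affine : ∀ α β γ → Σ[ A ∈ ℚ ] Σ[ B ∈ ℚ ] Σ[ C ∈ ℚ ] (∀ z → affine A B C z ≡ toℚ (α ℤ.* U z ℤ.+ β ℤ.* V z ℤ.+ γ))
  UV-affine α β γ = toℚ A , toℚ B , toℚ C , λ z → trans (sym (homs z)) (cong toℚ (UV-expand α β γ s e₁ e₂ d₁ d₂ p₁ p₂ (proj₁ z) (proj₂ z)))
    where
    p₁ = proj₁ p ; p₂ = proj₂ p ; d₁ = proj₁ d ; d₂ = proj₂ d ; e₁ = proj₁ e ; e₂ = proj₂ e
    A = α ℤ.* (s ℤ.* e₂) ℤ.+ β ℤ.* (ℤ.- (s ℤ.* d₂))
    B = α ℤ.* (ℤ.- (s ℤ.* e₁)) ℤ.+ β ℤ.* (s ℤ.* d₁)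
    C = α ℤ.* (s ℤ.* (p₂ ℤ.* e₁ ℤ.- p₁ ℤ.* e₂)) ℤ.+ β ℤ.* (s ℤ.* (d₂ ℤ.* p₁ ℤ.- d₁ ℤ.* p₂)) ℤ.+ γ
    homs : ∀ z → toℚ (A ℤ.* proj₁ z ℤ.+ B ℤ.* proj₂ z ℤ.+ C) ≡ affine (toℚ A) (toℚ B) (toℚ C) z
    homs (z₁ , z₂) = begin
      toℚ (A ℤ.* z₁ ℤ.+ B ℤ.* z₂ ℤ.+ C)                ≡⟨ toℚ-homo-+ (A ℤ.* z₁ ℤ.+ B ℤ.* z₂) C ⟩
      toℚ (A ℤ.* z₁ ℤ.+ B ℤ.* z₂) ℚ.+ toℚ C            ≡⟨ cong (ℚ._+ toℚ C) (toℚ-homo-+ (A ℤ.* z₁) (B ℤ.* z₂)) ⟩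
      toℚ (A ℤ.* z₁) ℚ.+ toℚ (B ℤ.* z₂) ℚ.+ toℚ C      ≡⟨ cong₂ (λ x y → x ℚ.+ y ℚ.+ toℚ C) (toℚ-homo-* A z₁) (toℚ-homo-* B z₂) ⟩
      toℚ A ℚ.* toℚ z₁ ℚ.+ toℚ B ℚ.* toℚ z₂ ℚ.+ toℚ C ∎
      where open ≡-Reasoning

  private
    collect₃ : ∀ w₀ w₁ w₂ u₀ u₁ u₂ v₀ v₁ v₂ P D E →
      w₀ ℚ.* (P ℚ.+ u₀ ℚ.* D ℚ.+ v₀ ℚ.* E) ℚ.+ (w₁ ℚ.* (P ℚ.+ u₁ ℚ.* D ℚ.+ v₁ ℚ.* E) ℚ.+ (w₂ ℚ.* (P ℚ.+ u₂ ℚ.* D ℚ.+ v₂ ℚ.* E) ℚ.+ 0ℚ))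
      ≡ (w₀ ℚ.+ (w₁ ℚ.+ (w₂ ℚ.+ 0ℚ))) ℚ.* P ℚ.+ (w₀ ℚ.* u₀ ℚ.+ w₁ ℚ.* u₁ ℚ.+ w₂ ℚ.* u₂) ℚ.* D ℚ.+ (w₀ ℚ.* v₀ ℚ.+ w₁ ℚ.* v₁ ℚ.+ w₂ ℚ.* v₂) ℚ.* E
    collect₃ = solve-∀ ℚ-ring

  barycentric : ∀ {z₀ z₁ z₂ u₀ u₁ u₂ v₀ v₁ v₂} →
    toPtℚ z₀ ≡ fromUV u₀ v₀ → toPtℚ z₁ ≡ fromUV u₁ v₁ → toPtℚ z₂ ≡ fromUV u₂ v₂ →
    (w : Fin 3 → ℚ) → sumF w ≡ 1ℚ →
    (combX (z₀ ∷ z₁ ∷ z₂ ∷ []) w , combY (z₀ ∷ z₁ ∷ z₂ ∷ []) w)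
    ≡ fromUV (w zero ℚ.* u₀ ℚ.+ w (suc zero) ℚ.* u₁ ℚ.+ w (suc (suc zero)) ℚ.* u₂)
             (w zero ℚ.* v₀ ℚ.+ w (suc zero) ℚ.* v₁ ℚ.+ w (suc (suc zero)) ℚ.* v₂)
  barycentric {u₀ = u₀} {u₁} {u₂} {v₀} {v₁} {v₂} z₀≡ z₁≡ z₂≡ w Σw≡1 = cong₂ _,_
    (coordinate P₁ D₁ E₁ (cong proj₁ z₀≡) (cong proj₁ z₁≡) (cong proj₁ z₂≡))
    (coordinate P₂ D₂ E₂ (cong proj₂ z₀≡) (cong proj₂ z₁≡) (cong proj₂ z₂≡))
    where
    w₀ = w zero ; w₁ = w (suc zero) ; w₂ = w (suc (suc zero))
    Σwu = w₀ ℚ.* u₀ ℚ.+ w₁ ℚ.* u₁ ℚ.+ w₂ ℚ.* u₂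
    Σwv = w₀ ℚ.* v₀ ℚ.+ w₁ ℚ.* v₁ ℚ.+ w₂ ℚ.* v₂
    coordinate : ∀ P D E {a₀ a₁ a₂} →
      a₀ ≡ P ℚ.+ u₀ ℚ.* D ℚ.+ v₀ ℚ.* E → a₁ ≡ P ℚ.+ u₁ ℚ.* D ℚ.+ v₁ ℚ.* E → a₂ ≡ P ℚ.+ u₂ ℚ.* D ℚ.+ v₂ ℚ.* E →
      w₀ ℚ.* a₀ ℚ.+ (w₁ ℚ.* a₁ ℚ.+ (w₂ ℚ.* a₂ ℚ.+ 0ℚ))
      ≡ P ℚ.+ Σwu ℚ.* D ℚ.+ Σwv ℚ.* E
    coordinate P D E refl refl refl =
      trans (collect₃ w₀ w₁ w₂ u₀ u₁ u₂ v₀ v₁ v₂ P D E)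
            (cong (λ t → t ℚ.+ Σwu ℚ.* D ℚ.+ Σwv ℚ.* E) (trans (cong (ℚ._* P) Σw≡1) (ℚP.*-identityˡ P)))

-- Lattice-path triangulations of the strip

data Step : Set where
  τ-step τ′-step : Step

stepᵢ stepⱼ : Step → ℕ → ℕ
stepᵢ τ-step  i = suc i
stepᵢ τ′-step i = i
stepⱼ τ-step  j = j
stepⱼ τ′-step j = suc j

endᵢ endⱼ : ℕ → List Step → ℕ
endᵢ i []       = i
endᵢ i (st ∷ s) = endᵢ (stepᵢ st i) s
endⱼ j []       = j
endⱼ j (st ∷ s) = endⱼ (stepⱼ st j) s

AllSteps : (ℕ → ℕ → Step → Set) → ℕ → ℕ → List Step → Set
AllSteps P i j []       = ⊤
AllSteps P i j (st ∷ s) = P i j st × AllSteps P (stepᵢ st i) (stepⱼ st j) s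

AllSteps-++ : ∀ {P} i j s₁ s₂ → AllSteps P i j s₁ → AllSteps P (endᵢ i s₁) (endⱼ j s₁) s₂ → AllSteps P i j (s₁ ++ s₂)
AllSteps-++ i j []        s₂ _          all₂ = all₂
AllSteps-++ i j (st ∷ s₁) s₂ (p , all₁) all₂ = p , AllSteps-++ (stepᵢ st i) (stepⱼ st j) s₁ s₂ all₁ all₂

endᵢ-++ : ∀ i s₁ s₂ → endᵢ i (s₁ ++ s₂) ≡ endᵢ (endᵢ i s₁) s₂
endᵢ-++ i []        s₂ = refl
endᵢ-++ i (st ∷ s₁) s₂ = endᵢ-++ (stepᵢ st i) s₁ s₂

endⱼ-++ : ∀ j s₁ s₂ → endⱼ j (s₁ ++ s₂) ≡ endⱼ (endⱼ j s₁) s₂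
endⱼ-++ j []        s₂ = refl
endⱼ-++ j (st ∷ s₁) s₂ = endⱼ-++ (stepⱼ st j) s₁ s₂

stairs : ℕ → List Step
stairs zero    = []
stairs (suc c) = τ′-step ∷ τ-step ∷ stairs c

stairs-end : ∀ k c → endᵢ k (stairs c) ≡ k ℕ.+ c × endⱼ k (stairs c) ≡ k ℕ.+ c
stairs-end k zero    = sym (ℕP.+-identityʳ k) , sym (ℕP.+-identityʳ k)
stairs-end k (suc c) = let eᵢ , eⱼ = stairs-end (suc k) c in trans eᵢ (sym (ℕP.+-suc k c)) , trans eⱼ (sym (ℕP.+-suc k c))

AllSteps-stairs : ∀ {P} k c → (∀ l → k ℕ.≤ l → l ℕ.< k ℕ.+ c → P l l τ′-step × P l (suc l) τ-step) → AllSteps P k k (stairs c)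
AllSteps-stairs k zero    all = tt
AllSteps-stairs k (suc c) all =
  let pτ′ , pτ = all k ℕP.≤-refl (ℕP.m<m+n k ℕ.z<s)
  in pτ′ , pτ , AllSteps-stairs (suc k) c (λ l k<l l<k+c → all l (ℕP.<⇒≤ k<l) (subst (l ℕ.<_) (sym (ℕP.+-suc k c)) l<k+c))

replicate-τ-end : ∀ i j c → endᵢ i (replicate c τ-step) ≡ i ℕ.+ c × endⱼ j (replicate c τ-step) ≡ j
replicate-τ-end i j zero    = sym (ℕP.+-identityʳ i) , refl
replicate-τ-end i j (suc c) = let eᵢ , eⱼ = replicate-τ-end (suc i) j c in trans eᵢ (sym (ℕP.+-suc i c)) , eⱼ

replicate-τ′-end : ∀ i j c → endᵢ i (replicate c τ′-step) ≡ i × endⱼ j (replicate c τ′-step) ≡ j ℕ.+ c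
replicate-τ′-end i j zero    = refl , sym (ℕP.+-identityʳ j)
replicate-τ′-end i j (suc c) = let eᵢ , eⱼ = replicate-τ′-end i (suc j) c in eᵢ , trans eⱼ (sym (ℕP.+-suc j c))

AllSteps-replicate-τ : ∀ {P} i j c → (∀ l → i ℕ.≤ l → l ℕ.< i ℕ.+ c → P l j τ-step) → AllSteps P i j (replicate c τ-step)
AllSteps-replicate-τ i j zero    all = tt
AllSteps-replicate-τ i j (suc c) all = all i ℕP.≤-refl (ℕP.m<m+n i ℕ.z<s) ,
  AllSteps-replicate-τ (suc i) j c (λ l i<l l<i+c → all l (ℕP.<⇒≤ i<l) (subst (l ℕ.<_) (sym (ℕP.+-suc i c)) l<i+c))

AllSteps-replicate-τ′ : ∀ {P} i j c → (∀ l → j ℕ.≤ l → l ℕ.< j ℕ.+ c → P i l τ′-step) → AllSteps P i j (replicate c τ′-step)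
AllSteps-replicate-τ′ i j zero    all = tt
AllSteps-replicate-τ′ i j (suc c) all = all j ℕP.≤-refl (ℕP.m<m+n j ℕ.z<s) ,
  AllSteps-replicate-τ′ i (suc j) c (λ l j<l l<j+c → all l (ℕP.<⇒≤ j<l) (subst (l ℕ.<_) (sym (ℕP.+-suc j c)) l<j+c))

staircase : ℕ → ℕ → List Step
staircase N K = stairs r ++ (replicate (N ∸ r) τ-step ++ replicate (suc (suc K) ∸ r) τ′-step)
  where r = N ⊓ suc K

staircase-starts-τ′ : ∀ N K → ∃ λ rest → staircase N K ≡ τ′-step ∷ rest
staircase-starts-τ′ zero    K = _ , refl
staircase-starts-τ′ (suc N) K = _ , refl

module PathTriangulation (p q d : Pt) (∣s∣≡1 : ∣ det d (q -ᵖ p) ∣ ≡ 1) where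

  open StripCoordinates p q d ∣s∣≡1 public

  triangle : ℕ → ℕ → Step → Tri
  triangle i j τ-step  = ν′ i , ν′ (suc i) , μ′ j
  triangle i j τ′-step = ν′ i , μ′ j , μ′ (suc j)

  pathTriangles : ℕ → ℕ → List Step → List Tri
  pathTriangles i j []       = []
  pathTriangles i j (st ∷ s) = triangle i j st ∷ pathTriangles (stepᵢ st i) (stepⱼ st j) s

  private
    unimodular-τ : ∀ p₁ p₂ q₁ q₂ d₁ d₂ i j →
      ((p₁ ℤ.+ (+ 1 ℤ.+ i) ℤ.* d₁) ℤ.- (p₁ ℤ.+ i ℤ.* d₁)) ℤ.* ((q₂ ℤ.+ j ℤ.* d₂) ℤ.- (p₂ ℤ.+ i ℤ.* d₂))
      ℤ.- ((p₂ ℤ.+ (+ 1 ℤ.+ i) ℤ.* d₂) ℤ.- (p₂ ℤ.+ i ℤ.* d₂)) ℤ.* ((q₁ ℤ.+ j ℤ.* d₁) ℤ.- (p₁ ℤ.+ i ℤ.* d₁))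
      ≡ d₁ ℤ.* (q₂ ℤ.- p₂) ℤ.- d₂ ℤ.* (q₁ ℤ.- p₁)
    unimodular-τ = ℤ-Solver.solve-∀
    unimodular-τ′ : ∀ p₁ p₂ q₁ q₂ d₁ d₂ i j →
      ((q₁ ℤ.+ j ℤ.* d₁) ℤ.- (p₁ ℤ.+ i ℤ.* d₁)) ℤ.* ((q₂ ℤ.+ (+ 1 ℤ.+ j) ℤ.* d₂) ℤ.- (p₂ ℤ.+ i ℤ.* d₂))
      ℤ.- ((q₂ ℤ.+ j ℤ.* d₂) ℤ.- (p₂ ℤ.+ i ℤ.* d₂)) ℤ.* ((q₁ ℤ.+ (+ 1 ℤ.+ j) ℤ.* d₁) ℤ.- (p₁ ℤ.+ i ℤ.* d₁))
      ≡ ℤ.- (d₁ ℤ.* (q₂ ℤ.- p₂) ℤ.- d₂ ℤ.* (q₁ ℤ.- p₁))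
    unimodular-τ′ = ℤ-Solver.solve-∀

  triangle-unimodular : ∀ i j st → Unimodular (triangle i j st)
  triangle-unimodular i j τ-step = trans (cong ∣_∣ (unimodular-τ (proj₁ p) (proj₂ p) (proj₁ q) (proj₂ q) (proj₁ d) (proj₂ d) (+ i) (+ j))) ∣s∣≡1
  triangle-unimodular i j τ′-step = trans (cong ∣_∣ (unimodular-τ′ (proj₁ p) (proj₂ p) (proj₁ q) (proj₂ q) (proj₁ d) (proj₂ d) (+ i) (+ j)))
    (trans (ℤP.∣-i∣≡∣i∣ s) ∣s∣≡1)

  pathTriangles-++ : ∀ i j s₁ s₂ → pathTriangles i j (s₁ ++ s₂) ≡ pathTriangles i j s₁ ++ pathTriangles (endᵢ i s₁) (endⱼ j s₁) s₂
  pathTriangles-++ i j []        s₂ = refl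
  pathTriangles-++ i j (st ∷ s₁) s₂ = cong (triangle i j st ∷_) (pathTriangles-++ (stepᵢ st i) (stepⱼ st j) s₁ s₂)

  AllSteps-∈ : ∀ {P T} i j s → AllSteps P i j s → Any (T ≡_) (pathTriangles i j s) →
    ∃₂ λ i′ j′ → Σ[ st ∈ Step ] (P i′ j′ st × T ≡ triangle i′ j′ st)
  AllSteps-∈ i j (st ∷ s) (p , _)   (here T≡)  = i , j , st , p , T≡
  AllSteps-∈ i j (st ∷ s) (_ , all) (there T∈) = AllSteps-∈ (stepᵢ st i) (stepⱼ st j) s all T∈

  ∈-stairs : ∀ k c l → k ℕ.≤ l → l ℕ.< k ℕ.+ c → Any (triangle l l τ′-step ≡_) (pathTriangles k k (stairs c))
  ∈-stairs k zero    l k≤l l<k+0 = ⊥-elim (ℕP.<-irrefl refl (ℕP.≤-<-trans k≤l (subst (l ℕ.<_) (ℕP.+-identityʳ k) l<k+0)))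
  ∈-stairs k (suc c) l k≤l l<k+1+c with ℕP.m≤n⇒m<n∨m≡n k≤l
  ... | inj₂ refl = here refl
  ... | inj₁ k<l  = there (there (∈-stairs (suc k) c l k<l (subst (l ℕ.<_) (ℕP.+-suc k c) l<k+1+c)))

  ∈-replicate-τ′ : ∀ i j c l → j ℕ.≤ l → l ℕ.< j ℕ.+ c → Any (triangle i l τ′-step ≡_) (pathTriangles i j (replicate c τ′-step))
  ∈-replicate-τ′ i j zero    l j≤l l<j+0 = ⊥-elim (ℕP.<-irrefl refl (ℕP.≤-<-trans j≤l (subst (l ℕ.<_) (ℕP.+-identityʳ j) l<j+0)))
  ∈-replicate-τ′ i j (suc c) l j≤l l<j+1+c with ℕP.m≤n⇒m<n∨m≡n j≤l
  ... | inj₂ refl = here refl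
  ... | inj₁ j<l  = there (∈-replicate-τ′ i (suc j) c l j<l (subst (l ℕ.<_) (ℕP.+-suc j c) l<j+1+c))

  InRelInt⇒coords : ∀ z₀ z₁ z₂ {u₀ u₁ u₂ v₀ v₁ v₂ x} → InRelInt (z₀ ∷ z₁ ∷ z₂ ∷ []) x →
    toPtℚ z₀ ≡ fromUV u₀ v₀ → toPtℚ z₁ ≡ fromUV u₁ v₁ → toPtℚ z₂ ≡ fromUV u₂ v₂ →
    Σ[ w ∈ (Fin 3 → ℚ) ] ((∀ k → 0ℚ ℚ.< w k) × sumF w ≡ 1ℚ
      × uℚ x ≡ w zero ℚ.* u₀ ℚ.+ w (suc zero) ℚ.* u₁ ℚ.+ w (suc (suc zero)) ℚ.* u₂
      × vℚ x ≡ w zero ℚ.* v₀ ℚ.+ w (suc zero) ℚ.* v₁ ℚ.+ w (suc (suc zero)) ℚ.* v₂)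
  InRelInt⇒coords z₀ z₁ z₂ {u₀} {u₁} {u₂} {v₀} {v₁} {v₂} {x} (w , 0<w , Σw≡1 , wx , wy) z₀≡ z₁≡ z₂≡ =
    w , 0<w , Σw≡1 , trans (cong uℚ x≡) (uℚ-fromUV Σwu Σwv) , trans (cong vℚ x≡) (vℚ-fromUV Σwu Σwv)
    where
    Σwu = w zero ℚ.* u₀ ℚ.+ w (suc zero) ℚ.* u₁ ℚ.+ w (suc (suc zero)) ℚ.* u₂
    Σwv = w zero ℚ.* v₀ ℚ.+ w (suc zero) ℚ.* v₁ ℚ.+ w (suc (suc zero)) ℚ.* v₂
    x≡ : x ≡ fromUV Σwu Σwv
    x≡ = trans (sym (cong₂ _,_ wx wy)) (barycentric {z₀} {z₁} {z₂} {u₀} {u₁} {u₂} {v₀} {v₁} {v₂} z₀≡ z₁≡ z₂≡ w Σw≡1)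

  coords⇒InConv : ∀ z₀ z₁ z₂ {u₀ u₁ u₂ v₀ v₁ v₂ x} →
    toPtℚ z₀ ≡ fromUV u₀ v₀ → toPtℚ z₁ ≡ fromUV u₁ v₁ → toPtℚ z₂ ≡ fromUV u₂ v₂ →
    (w : Fin 3 → ℚ) → (∀ k → 0ℚ ℚ.≤ w k) → sumF w ≡ 1ℚ →
    w zero ℚ.* u₀ ℚ.+ w (suc zero) ℚ.* u₁ ℚ.+ w (suc (suc zero)) ℚ.* u₂ ≡ uℚ x →
    w zero ℚ.* v₀ ℚ.+ w (suc zero) ℚ.* v₁ ℚ.+ w (suc (suc zero)) ℚ.* v₂ ≡ vℚ x →
    InConv (z₀ ∷ z₁ ∷ z₂ ∷ []) x
  coords⇒InConv z₀ z₁ z₂ {u₀} {u₁} {u₂} {v₀} {v₁} {v₂} {x} z₀≡ z₁≡ z₂≡ w 0≤w Σw≡1 Σwu≡u Σwv≡v =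
    w , 0≤w , Σw≡1 , cong proj₁ x≡ , cong proj₂ x≡
    where
    x≡ = trans (barycentric {z₀} {z₁} {z₂} {u₀} {u₁} {u₂} {v₀} {v₁} {v₂} z₀≡ z₁≡ z₂≡ w Σw≡1) (trans (cong₂ fromUV Σwu≡u Σwv≡v) (fromUV-uℚ-vℚ x))

  toPtℚ-ν′-suc : ∀ i → toPtℚ (ν′ (suc i)) ≡ fromUV (1ℚ ℚ.+ toℚ (+ i)) 0ℚ
  toPtℚ-ν′-suc i = trans (toPtℚ-ν′ (suc i)) (cong (λ t → fromUV t 0ℚ) (toℚ-suc i))

  toPtℚ-μ′-suc : ∀ j → toPtℚ (μ′ (suc j)) ≡ fromUV (1ℚ ℚ.+ toℚ (+ j)) 1ℚ
  toPtℚ-μ′-suc j = trans (toPtℚ-μ′ (suc j)) (cong (λ t → fromUV t 1ℚ) (toℚ-suc j))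

  -- side i j vanishes on the line through ν′ i and μ′ j and drops by stepDrop at every step of a path,
  -- so a point of C lies in the triangle where it changes sign, and interiors of distinct triangles are disjoint.
  sideAt : ℚ → ℚ → Ptℚ → ℚ
  sideAt I J x = uℚ x ℚ.- I ℚ.* (1ℚ ℚ.- vℚ x) ℚ.- J ℚ.* vℚ x

  side : ℕ → ℕ → Ptℚ → ℚ
  side i j = sideAt (toℚ (+ i)) (toℚ (+ j))

  side-suc-i : ∀ i j x → side (suc i) j x ≡ sideAt (1ℚ ℚ.+ toℚ (+ i)) (toℚ (+ j)) x
  side-suc-i i j x = cong (λ t → sideAt t (toℚ (+ j)) x) (toℚ-suc i)

  side-suc-j : ∀ i j x → side i (suc j) x ≡ sideAt (toℚ (+ i)) (1ℚ ℚ.+ toℚ (+ j)) x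
  side-suc-j i j x = cong (λ t → sideAt (toℚ (+ i)) t x) (toℚ-suc j)

  sideAt-coords : ∀ I J x {u v o} → uℚ x ≡ u → vℚ x ≡ v → o ≡ 1ℚ →
    sideAt I J x ≡ u ℚ.- I ℚ.* (o ℚ.- v) ℚ.- J ℚ.* v
  sideAt-coords I J x refl refl refl = refl

  Affine-sideAt : ∀ I J → Affine (sideAt I J)
  Affine-sideAt I J = Affine-≗ (affine-combination Affine-uℚ Affine-vℚ 1ℚ (I ℚ.- J) (ℚ.- I)) λ x → expand (uℚ x) (vℚ x) I J
    where
    expand : ∀ u v I J → 1ℚ ℚ.* u ℚ.+ (I ℚ.- J) ℚ.* v ℚ.+ ℚ.- I ≡ u ℚ.- I ℚ.* (1ℚ ℚ.- v) ℚ.- J ℚ.* v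
    expand = solve-∀ ℚ-ring

  private
    side-on-τ : ∀ K I J → K ℚ.- I ℚ.* (1ℚ ℚ.- 0ℚ) ℚ.- J ℚ.* 0ℚ ≡ K ℚ.- I
    side-on-τ = solve-∀ ℚ-ring
    side-on-τ′ : ∀ K I J → K ℚ.- I ℚ.* (1ℚ ℚ.- 1ℚ) ℚ.- J ℚ.* 1ℚ ≡ K ℚ.- J
    side-on-τ′ = solve-∀ ℚ-ring

  sideAt-ν′ : ∀ I J k → sideAt I J (toPtℚ (ν′ k)) ≡ toℚ (+ k) ℚ.- I
  sideAt-ν′ I J k = trans (sideAt-coords I J (toPtℚ (ν′ k)) (uℚ-ν′ k) (vℚ-ν′ k) refl) (side-on-τ (toℚ (+ k)) I J)

  sideAt-μ′ : ∀ I J k → sideAt I J (toPtℚ (μ′ k)) ≡ toℚ (+ k) ℚ.- J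
  sideAt-μ′ I J k = trans (sideAt-coords I J (toPtℚ (μ′ k)) (uℚ-μ′ k) (vℚ-μ′ k) refl) (side-on-τ′ (toℚ (+ k)) I J)

  stepDrop : Step → Ptℚ → ℚ
  stepDrop τ-step  x = 1ℚ ℚ.- vℚ x
  stepDrop τ′-step x = vℚ x

  private
    drop-τ : ∀ u v I J → u ℚ.- I ℚ.* (1ℚ ℚ.- v) ℚ.- J ℚ.* v ≡ (u ℚ.- (1ℚ ℚ.+ I) ℚ.* (1ℚ ℚ.- v) ℚ.- J ℚ.* v) ℚ.+ (1ℚ ℚ.- v)
    drop-τ = solve-∀ ℚ-ring
    drop-τ′ : ∀ u v I J → u ℚ.- I ℚ.* (1ℚ ℚ.- v) ℚ.- J ℚ.* v ≡ (u ℚ.- I ℚ.* (1ℚ ℚ.- v) ℚ.- (1ℚ ℚ.+ J) ℚ.* v) ℚ.+ v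
    drop-τ′ = solve-∀ ℚ-ring

  side-step : ∀ i j st x → side i j x ≡ side (stepᵢ st i) (stepⱼ st j) x ℚ.+ stepDrop st x
  side-step i j τ-step x = trans (drop-τ (uℚ x) (vℚ x) (toℚ (+ i)) (toℚ (+ j)))
    (cong (ℚ._+ stepDrop τ-step x) (sym (side-suc-i i j x)))
  side-step i j τ′-step x = trans (drop-τ′ (uℚ x) (vℚ x) (toℚ (+ i)) (toℚ (+ j)))
    (cong (ℚ._+ stepDrop τ′-step x) (sym (side-suc-j i j x)))

  private
    τ-side : ∀ w₀ w₁ w₂ I J →
      (w₀ ℚ.* I ℚ.+ w₁ ℚ.* (1ℚ ℚ.+ I) ℚ.+ w₂ ℚ.* J) ℚ.- I ℚ.* ((w₀ ℚ.+ (w₁ ℚ.+ (w₂ ℚ.+ 0ℚ))) ℚ.- (w₀ ℚ.* 0ℚ ℚ.+ w₁ ℚ.* 0ℚ ℚ.+ w₂ ℚ.* 1ℚ))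
        ℚ.- J ℚ.* (w₀ ℚ.* 0ℚ ℚ.+ w₁ ℚ.* 0ℚ ℚ.+ w₂ ℚ.* 1ℚ) ≡ w₁
    τ-side = solve-∀ ℚ-ring
    τ-side-next : ∀ w₀ w₁ w₂ I J →
      (w₀ ℚ.* I ℚ.+ w₁ ℚ.* (1ℚ ℚ.+ I) ℚ.+ w₂ ℚ.* J) ℚ.- (1ℚ ℚ.+ I) ℚ.* ((w₀ ℚ.+ (w₁ ℚ.+ (w₂ ℚ.+ 0ℚ))) ℚ.- (w₀ ℚ.* 0ℚ ℚ.+ w₁ ℚ.* 0ℚ ℚ.+ w₂ ℚ.* 1ℚ))
        ℚ.- J ℚ.* (w₀ ℚ.* 0ℚ ℚ.+ w₁ ℚ.* 0ℚ ℚ.+ w₂ ℚ.* 1ℚ) ≡ ℚ.- w₀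
    τ-side-next = solve-∀ ℚ-ring
    τ-v : ∀ w₀ w₁ w₂ → w₀ ℚ.* 0ℚ ℚ.+ w₁ ℚ.* 0ℚ ℚ.+ w₂ ℚ.* 1ℚ ≡ w₂
    τ-v = solve-∀ ℚ-ring
    τ-1-v : ∀ w₀ w₁ w₂ → (w₀ ℚ.+ (w₁ ℚ.+ (w₂ ℚ.+ 0ℚ))) ℚ.- (w₀ ℚ.* 0ℚ ℚ.+ w₁ ℚ.* 0ℚ ℚ.+ w₂ ℚ.* 1ℚ) ≡ w₀ ℚ.+ w₁
    τ-1-v = solve-∀ ℚ-ring
    τ′-side : ∀ w₀ w₁ w₂ I J →
      (w₀ ℚ.* I ℚ.+ w₁ ℚ.* J ℚ.+ w₂ ℚ.* (1ℚ ℚ.+ J)) ℚ.- I ℚ.* ((w₀ ℚ.+ (w₁ ℚ.+ (w₂ ℚ.+ 0ℚ))) ℚ.- (w₀ ℚ.* 0ℚ ℚ.+ w₁ ℚ.* 1ℚ ℚ.+ w₂ ℚ.* 1ℚ))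
        ℚ.- J ℚ.* (w₀ ℚ.* 0ℚ ℚ.+ w₁ ℚ.* 1ℚ ℚ.+ w₂ ℚ.* 1ℚ) ≡ w₂
    τ′-side = solve-∀ ℚ-ring
    τ′-side-next : ∀ w₀ w₁ w₂ I J →
      (w₀ ℚ.* I ℚ.+ w₁ ℚ.* J ℚ.+ w₂ ℚ.* (1ℚ ℚ.+ J)) ℚ.- I ℚ.* ((w₀ ℚ.+ (w₁ ℚ.+ (w₂ ℚ.+ 0ℚ))) ℚ.- (w₀ ℚ.* 0ℚ ℚ.+ w₁ ℚ.* 1ℚ ℚ.+ w₂ ℚ.* 1ℚ))
        ℚ.- (1ℚ ℚ.+ J) ℚ.* (w₀ ℚ.* 0ℚ ℚ.+ w₁ ℚ.* 1ℚ ℚ.+ w₂ ℚ.* 1ℚ) ≡ ℚ.- w₁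
    τ′-side-next = solve-∀ ℚ-ring
    τ′-v : ∀ w₀ w₁ w₂ → w₀ ℚ.* 0ℚ ℚ.+ w₁ ℚ.* 1ℚ ℚ.+ w₂ ℚ.* 1ℚ ≡ w₁ ℚ.+ w₂
    τ′-v = solve-∀ ℚ-ring
    τ′-1-v : ∀ w₀ w₁ w₂ → (w₀ ℚ.+ (w₁ ℚ.+ (w₂ ℚ.+ 0ℚ))) ℚ.- (w₀ ℚ.* 0ℚ ℚ.+ w₁ ℚ.* 1ℚ ℚ.+ w₂ ℚ.* 1ℚ) ≡ w₀
    τ′-1-v = solve-∀ ℚ-ring

  interior-step : ∀ i j st x → InRelInt (verts (triangle i j st)) x →
    0ℚ ℚ.< side i j x × side (stepᵢ st i) (stepⱼ st j) x ℚ.< 0ℚ × 0ℚ ℚ.< vℚ x × 0ℚ ℚ.< 1ℚ ℚ.- vℚ x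
  interior-step i j τ-step x x∈T° =
    let w , 0<w , Σw≡1 , u≡ , v≡ = InRelInt⇒coords (ν′ i) (ν′ (suc i)) (μ′ j) x∈T° (toPtℚ-ν′ i) (toPtℚ-ν′-suc i) (toPtℚ-μ′ j)
        w₀ = w zero ; w₁ = w (suc zero) ; w₂ = w (suc (suc zero))
    in
    subst (0ℚ ℚ.<_) (sym (trans (sideAt-coords I J x u≡ v≡ Σw≡1) (τ-side w₀ w₁ w₂ I J))) (0<w (suc zero)) ,
    subst (ℚ._< 0ℚ) (sym (trans (side-suc-i i j x) (trans (sideAt-coords (1ℚ ℚ.+ I) J x u≡ v≡ Σw≡1) (τ-side-next w₀ w₁ w₂ I J))))
      (ℚP.neg-antimono-< (0<w zero)) ,
    subst (0ℚ ℚ.<_) (sym (trans v≡ (τ-v w₀ w₁ w₂))) (0<w (suc (suc zero))) ,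
    subst (0ℚ ℚ.<_) (sym (trans (cong₂ ℚ._-_ (sym Σw≡1) v≡) (τ-1-v w₀ w₁ w₂))) (0<-+ (0<w zero) (ℚP.<⇒≤ (0<w (suc zero))))
    where
    I = toℚ (+ i) ; J = toℚ (+ j)
  interior-step i j τ′-step x x∈T° =
    let w , 0<w , Σw≡1 , u≡ , v≡ = InRelInt⇒coords (ν′ i) (μ′ j) (μ′ (suc j)) x∈T° (toPtℚ-ν′ i) (toPtℚ-μ′ j) (toPtℚ-μ′-suc j)
        w₀ = w zero ; w₁ = w (suc zero) ; w₂ = w (suc (suc zero))
    in
    subst (0ℚ ℚ.<_) (sym (trans (sideAt-coords I J x u≡ v≡ Σw≡1) (τ′-side w₀ w₁ w₂ I J))) (0<w (suc (suc zero))) ,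
    subst (ℚ._< 0ℚ) (sym (trans (side-suc-j i j x) (trans (sideAt-coords I (1ℚ ℚ.+ J) x u≡ v≡ Σw≡1) (τ′-side-next w₀ w₁ w₂ I J))))
      (ℚP.neg-antimono-< (0<w (suc zero))) ,
    subst (0ℚ ℚ.<_) (sym (trans v≡ (τ′-v w₀ w₁ w₂))) (0<-+ (0<w (suc zero)) (ℚP.<⇒≤ (0<w (suc (suc zero))))) ,
    subst (0ℚ ℚ.<_) (sym (trans (cong₂ ℚ._-_ (sym Σw≡1) v≡) (τ′-1-v w₀ w₁ w₂))) (0<w zero)
    where
    I = toℚ (+ i) ; J = toℚ (+ j)

  private
    τ-Σw : ∀ u v I J → ℚ.- (u ℚ.- (1ℚ ℚ.+ I) ℚ.* (1ℚ ℚ.- v) ℚ.- J ℚ.* v) ℚ.+ ((u ℚ.- I ℚ.* (1ℚ ℚ.- v) ℚ.- J ℚ.* v) ℚ.+ (v ℚ.+ 0ℚ)) ≡ 1ℚ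
    τ-Σw = solve-∀ ℚ-ring
    τ-Σwu : ∀ u v I J → ℚ.- (u ℚ.- (1ℚ ℚ.+ I) ℚ.* (1ℚ ℚ.- v) ℚ.- J ℚ.* v) ℚ.* I ℚ.+ (u ℚ.- I ℚ.* (1ℚ ℚ.- v) ℚ.- J ℚ.* v) ℚ.* (1ℚ ℚ.+ I) ℚ.+ v ℚ.* J ≡ u
    τ-Σwu = solve-∀ ℚ-ring
    τ-Σwv : ∀ a b v → a ℚ.* 0ℚ ℚ.+ b ℚ.* 0ℚ ℚ.+ v ℚ.* 1ℚ ≡ v
    τ-Σwv = solve-∀ ℚ-ring
    τ′-Σw : ∀ u v I J → (1ℚ ℚ.- v) ℚ.+ (ℚ.- (u ℚ.- I ℚ.* (1ℚ ℚ.- v) ℚ.- (1ℚ ℚ.+ J) ℚ.* v) ℚ.+ ((u ℚ.- I ℚ.* (1ℚ ℚ.- v) ℚ.- J ℚ.* v) ℚ.+ 0ℚ)) ≡ 1ℚ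
    τ′-Σw = solve-∀ ℚ-ring
    τ′-Σwu : ∀ u v I J → (1ℚ ℚ.- v) ℚ.* I ℚ.+ ℚ.- (u ℚ.- I ℚ.* (1ℚ ℚ.- v) ℚ.- (1ℚ ℚ.+ J) ℚ.* v) ℚ.* J ℚ.+ (u ℚ.- I ℚ.* (1ℚ ℚ.- v) ℚ.- J ℚ.* v) ℚ.* (1ℚ ℚ.+ J) ≡ u
    τ′-Σwu = solve-∀ ℚ-ring
    τ′-Σwv : ∀ u v I J → (1ℚ ℚ.- v) ℚ.* 0ℚ ℚ.+ ℚ.- (u ℚ.- I ℚ.* (1ℚ ℚ.- v) ℚ.- (1ℚ ℚ.+ J) ℚ.* v) ℚ.* 1ℚ ℚ.+ (u ℚ.- I ℚ.* (1ℚ ℚ.- v) ℚ.- J ℚ.* v) ℚ.* 1ℚ ≡ v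
    τ′-Σwv = solve-∀ ℚ-ring

  between-sides⇒InConv : ∀ i j st x → 0ℚ ℚ.≤ vℚ x → 0ℚ ℚ.≤ 1ℚ ℚ.- vℚ x →
    0ℚ ℚ.≤ side i j x → side (stepᵢ st i) (stepⱼ st j) x ℚ.≤ 0ℚ → InConv (verts (triangle i j st)) x
  between-sides⇒InConv i j τ-step x 0≤v _ 0≤side side′≤0 =
    coords⇒InConv (ν′ i) (ν′ (suc i)) (μ′ j) (toPtℚ-ν′ i) (toPtℚ-ν′-suc i) (toPtℚ-μ′ j) w
      (weights₃-∀ {ℚ._≤_ 0ℚ} (ℚP.neg-antimono-≤ side′≤0) 0≤side 0≤v)
      (trans (cong (λ t → ℚ.- t ℚ.+ (side i j x ℚ.+ (v ℚ.+ 0ℚ))) (side-suc-i i j x)) (τ-Σw u v I J))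
      (trans (cong (λ t → ℚ.- t ℚ.* I ℚ.+ side i j x ℚ.* (1ℚ ℚ.+ I) ℚ.+ v ℚ.* J) (side-suc-i i j x)) (τ-Σwu u v I J))
      (τ-Σwv (ℚ.- side (suc i) j x) (side i j x) v)
    where
    u = uℚ x ; v = vℚ x ; I = toℚ (+ i) ; J = toℚ (+ j)
    w = weights₃ (ℚ.- side (suc i) j x) (side i j x) v
  between-sides⇒InConv i j τ′-step x _ 0≤1-v 0≤side side′≤0 =
    coords⇒InConv (ν′ i) (μ′ j) (μ′ (suc j)) (toPtℚ-ν′ i) (toPtℚ-μ′ j) (toPtℚ-μ′-suc j) w
      (weights₃-∀ {ℚ._≤_ 0ℚ} 0≤1-v (ℚP.neg-antimono-≤ side′≤0) 0≤side)
      (trans (cong (λ t → (1ℚ ℚ.- v) ℚ.+ (ℚ.- t ℚ.+ (side i j x ℚ.+ 0ℚ))) (side-suc-j i j x)) (τ′-Σw u v I J))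
      (trans (cong (λ t → (1ℚ ℚ.- v) ℚ.* I ℚ.+ ℚ.- t ℚ.* J ℚ.+ side i j x ℚ.* (1ℚ ℚ.+ J)) (side-suc-j i j x)) (τ′-Σwu u v I J))
      (trans (cong (λ t → (1ℚ ℚ.- v) ℚ.* 0ℚ ℚ.+ ℚ.- t ℚ.* 1ℚ ℚ.+ side i j x ℚ.* 1ℚ) (side-suc-j i j x)) (τ′-Σwv u v I J))
    where
    u = uℚ x ; v = vℚ x ; I = toℚ (+ i) ; J = toℚ (+ j)
    w = weights₃ (1ℚ ℚ.- v) (ℚ.- side i (suc j) x) (side i j x)


  cover : ∀ i j st s x → 0ℚ ℚ.≤ vℚ x → 0ℚ ℚ.≤ 1ℚ ℚ.- vℚ x →
    0ℚ ℚ.≤ side i j x → side (endᵢ i (st ∷ s)) (endⱼ j (st ∷ s)) x ℚ.≤ 0ℚ →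
    Any (λ T → InConv (verts T) x) (pathTriangles i j (st ∷ s))
  cover i j st []         x 0≤v 0≤1-v 0≤side end≤0 = here (between-sides⇒InConv i j st x 0≤v 0≤1-v 0≤side end≤0)
  cover i j st (st′ ∷ s) x 0≤v 0≤1-v 0≤side end≤0 = split (side (stepᵢ st i) (stepⱼ st j) x ℚP.≤? 0ℚ)
    where
    split : Dec (side (stepᵢ st i) (stepⱼ st j) x ℚ.≤ 0ℚ) → Any (λ T → InConv (verts T) x) (pathTriangles i j (st ∷ st′ ∷ s))
    split (yes next≤0) = here (between-sides⇒InConv i j st x 0≤v 0≤1-v 0≤side next≤0)
    split (no  next≰0) = there (cover (stepᵢ st i) (stepⱼ st j) st′ s x 0≤v 0≤1-v (ℚP.<⇒≤ (ℚP.≰⇒> next≰0)) end≤0)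

  stepDrop-pos : ∀ st x → 0ℚ ℚ.< vℚ x → 0ℚ ℚ.< 1ℚ ℚ.- vℚ x → 0ℚ ℚ.< stepDrop st x
  stepDrop-pos τ-step  x 0<v 0<1-v = 0<1-v
  stepDrop-pos τ′-step x 0<v 0<1-v = 0<v

  interior⇒0<side : ∀ i j s r x → InRelInt (verts (lookup (pathTriangles i j s) r)) x →
    0ℚ ℚ.< side i j x × 0ℚ ℚ.< vℚ x × 0ℚ ℚ.< 1ℚ ℚ.- vℚ x
  interior⇒0<side i j (st ∷ s) zero x x∈T° =
    let 0<side , _ , 0<v , 0<1-v = interior-step i j st x x∈T° in 0<side , 0<v , 0<1-v
  interior⇒0<side i j (st ∷ s) (suc r) x x∈T° =
    let 0<side′ , 0<v , 0<1-v = interior⇒0<side (stepᵢ st i) (stepⱼ st j) s r x x∈T°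
    in subst (0ℚ ℚ.<_) (sym (side-step i j st x)) (0<-+ 0<side′ (ℚP.<⇒≤ (stepDrop-pos st x 0<v 0<1-v))) , 0<v , 0<1-v

  pathTriangles-disjoint : ∀ i j s (r r′ : Fin (length (pathTriangles i j s))) → r ≢ r′ → ∀ x →
    ¬ (InRelInt (verts (lookup (pathTriangles i j s) r)) x × InRelInt (verts (lookup (pathTriangles i j s) r′)) x)
  pathTriangles-disjoint i j (st ∷ s) zero    zero     r≢r′ x _ = r≢r′ refl
  pathTriangles-disjoint i j (st ∷ s) zero    (suc r′) r≢r′ x (x∈T° , x∈T′°) =
    ℚP.<-asym (proj₁ (proj₂ (interior-step i j st x x∈T°))) (proj₁ (interior⇒0<side (stepᵢ st i) (stepⱼ st j) s r′ x x∈T′°))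
  pathTriangles-disjoint i j (st ∷ s) (suc r) zero     r≢r′ x (x∈T° , x∈T′°) =
    ℚP.<-asym (proj₁ (proj₂ (interior-step i j st x x∈T′°))) (proj₁ (interior⇒0<side (stepᵢ st i) (stepⱼ st j) s r x x∈T°))
  pathTriangles-disjoint i j (st ∷ s) (suc r) (suc r′) r≢r′ x =
    pathTriangles-disjoint (stepᵢ st i) (stepⱼ st j) s r r′ (r≢r′ ∘ cong suc) x

-- Crossing edges

module CrossingEdges (p q d : Pt) (∣s∣≡1 : ∣ det d (q -ᵖ p) ∣ ≡ 1) where

  open StripCoordinates p q d ∣s∣≡1

  private
    det-diagonals : ∀ p₁ p₂ q₁ q₂ d₁ d₂ i a T₁ T₂ →
      ((q₁ ℤ.+ (a ℤ.+ T₁) ℤ.* d₁) ℤ.- (p₁ ℤ.+ i ℤ.* d₁)) ℤ.* ((q₂ ℤ.+ a ℤ.* d₂) ℤ.- (p₂ ℤ.+ (i ℤ.+ T₂) ℤ.* d₂))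
      ℤ.- ((q₂ ℤ.+ (a ℤ.+ T₁) ℤ.* d₂) ℤ.- (p₂ ℤ.+ i ℤ.* d₂)) ℤ.* ((q₁ ℤ.+ a ℤ.* d₁) ℤ.- (p₁ ℤ.+ (i ℤ.+ T₂) ℤ.* d₁))
      ≡ (d₁ ℤ.* (q₂ ℤ.- p₂) ℤ.- d₂ ℤ.* (q₁ ℤ.- p₁)) ℤ.* (T₁ ℤ.+ T₂)
    det-diagonals = ℤ-Solver.solve-∀
    det-shift₁ : ∀ s σ ρ x₁ y₁ x₂ y₂ → x₁ ℤ.* (s ℤ.* (σ ℤ.* y₂ ℤ.- ρ ℤ.* y₁)) ℤ.- y₁ ℤ.* (s ℤ.* (σ ℤ.* x₂ ℤ.- ρ ℤ.* x₁))
      ≡ s ℤ.* σ ℤ.* (x₁ ℤ.* y₂ ℤ.- y₁ ℤ.* x₂)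
    det-shift₁ = ℤ-Solver.solve-∀
    det-shift₂ : ∀ s σ ρ x₁ y₁ x₂ y₂ → x₂ ℤ.* (s ℤ.* (σ ℤ.* y₂ ℤ.- ρ ℤ.* y₁)) ℤ.- y₂ ℤ.* (s ℤ.* (σ ℤ.* x₂ ℤ.- ρ ℤ.* x₁))
      ≡ s ℤ.* ρ ℤ.* (x₁ ℤ.* y₂ ℤ.- y₁ ℤ.* x₂)
    det-shift₂ = ℤ-Solver.solve-∀
    regroup : ∀ σ s X → σ ℤ.* (s ℤ.* σ ℤ.* (s ℤ.* X)) ≡ (σ ℤ.* σ) ℤ.* (s ℤ.* s) ℤ.* X
    regroup = ℤ-Solver.solve-∀
    same-crossing : ∀ p q d i a T₁ T₂ → T₁ ℤ.* (p ℤ.+ i ℤ.* d) ℤ.+ T₂ ℤ.* (q ℤ.+ (a ℤ.+ T₁) ℤ.* d)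
      ≡ T₁ ℤ.* (p ℤ.+ (i ℤ.+ T₂) ℤ.* d) ℤ.+ T₂ ℤ.* (q ℤ.+ a ℤ.* d)
    same-crossing = ℤ-Solver.solve-∀

  -- ν′ i μ′ b and ν′ k μ′ a (i < k, a < b) cross at (T₁ ν′ i + T₂ μ′ b) / (T₁ + T₂) = (T₁ ν′ k + T₂ μ′ a) / (T₁ + T₂),
  -- where b = a + T₁ and k = i + T₂; the shift δ points into the third vertex's side of both edges.
  module _ (i t₂ a t₁ : ℕ) (w₁ w₂ : Pt) where

    T₁ T₂ : ℤ
    T₁ = + suc t₁
    T₂ = + suc t₂

    νᵢ μ_b ν_k μₐ : Pt
    νᵢ  = ν′ i
    μ_b = μ′ (a ℕ.+ suc t₁)
    ν_k = ν′ (i ℕ.+ suc t₂)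
    μₐ  = μ′ a

    r₁ r₂ : Pt
    r₁ = μ_b -ᵖ νᵢ
    r₂ = μₐ -ᵖ ν_k

    σ ρ : ℤ
    σ = orientation νᵢ μ_b w₁
    ρ = orientation ν_k μₐ w₂

    δ : Pt
    δ = s *ᵖ ((σ *ᵖ r₂) -ᵖ (ρ *ᵖ r₁))

    det-edges : det r₁ r₂ ≡ s ℤ.* (T₁ ℤ.+ T₂)
    det-edges = det-diagonals (proj₁ p) (proj₂ p) (proj₁ q) (proj₂ q) (proj₁ d) (proj₂ d) (+ i) (+ a) T₁ T₂

    apexCoord≡ : ∀ τ → τ ℤ.* τ ≡ + 1 → τ ℤ.* (s ℤ.* τ ℤ.* (s ℤ.* (T₁ ℤ.+ T₂))) ≡ T₁ ℤ.+ T₂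
    apexCoord≡ τ τ²≡1 = trans (regroup τ s (T₁ ℤ.+ T₂))
      (trans (cong₂ (λ x y → x ℤ.* y ℤ.* (T₁ ℤ.+ T₂)) τ²≡1 s²≡1) (ℤP.*-identityˡ (T₁ ℤ.+ T₂)))

    crossing-interiors : Unimodular (νᵢ , μ_b , w₁) → Unimodular (ν_k , μₐ , w₂) →
      ∃ λ x → InRelInt (verts (νᵢ , μ_b , w₁)) x × InRelInt (verts (ν_k , μₐ , w₂)) x
    crossing-interiors u₁ u₂ =
      point ν_k μₐ ,
      subst (InRelInt (verts (νᵢ , μ_b , w₁))) (cong (λ z → ((N *ᵖ z) +ᵖ δ) /[1+ K ]ᵖ) crossing-point)
        (near-edge-interior νᵢ μ_b w₁ δ N T₁ T₂ K σ²≡1 (0<[1+m][1+n]+c M t₁ c₀ ∣c₀∣≤M) (0<[1+m][1+n]+c M t₂ c₁ ∣c₁∣≤M) 0<c₂ refl) ,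
      near-edge-interior ν_k μₐ w₂ δ N T₁ T₂ K ρ²≡1 (0<[1+m][1+n]+c M t₁ c₀′ ∣c₀′∣≤M) (0<[1+m][1+n]+c M t₂ c₁′ ∣c₁′∣≤M) 0<c₂′ refl
      where
      σ²≡1 = ∣i∣≡1⇒i*i≡1 σ u₁
      ρ²≡1 = ∣i∣≡1⇒i*i≡1 ρ u₂
      c₁ = edgeCoord νᵢ μ_b w₁ δ
      c₀ = ℤ.- (c₁ ℤ.+ apexCoord νᵢ μ_b w₁ δ)
      c₁′ = edgeCoord ν_k μₐ w₂ δ
      c₀′ = ℤ.- (c₁′ ℤ.+ apexCoord ν_k μₐ w₂ δ)
      M = ∣ c₀ ∣ ℕ.+ ∣ c₁ ∣ ℕ.+ ∣ c₀′ ∣ ℕ.+ ∣ c₁′ ∣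
      N = + suc M
      K = t₁ ℕ.+ suc t₂ ℕ.+ M ℕ.* (suc t₁ ℕ.+ suc t₂)
      point : Pt → Pt → Ptℚ
      point v w = ((N *ᵖ ((T₁ *ᵖ v) +ᵖ (T₂ *ᵖ w))) +ᵖ δ) /[1+ K ]ᵖ
      crossing-point : (T₁ *ᵖ νᵢ) +ᵖ (T₂ *ᵖ μ_b) ≡ (T₁ *ᵖ ν_k) +ᵖ (T₂ *ᵖ μₐ)
      crossing-point = cong₂ _,_ (same-crossing (proj₁ p) (proj₁ q) (proj₁ d) (+ i) (+ a) T₁ T₂)
                                 (same-crossing (proj₂ p) (proj₂ q) (proj₂ d) (+ i) (+ a) T₁ T₂)
      0<T₁+T₂ : + 0 ℤ.< T₁ ℤ.+ T₂
      0<T₁+T₂ = ℤ.+<+ (s≤s z≤n)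
      0<c₂ : + 0 ℤ.< apexCoord νᵢ μ_b w₁ δ
      0<c₂ = subst (+ 0 ℤ.<_) (sym (trans (cong (σ ℤ.*_) (trans (det-shift₁ s σ ρ (proj₁ r₁) (proj₂ r₁) (proj₁ r₂) (proj₂ r₂)) (cong (s ℤ.* σ ℤ.*_) det-edges)))
        (apexCoord≡ σ σ²≡1))) 0<T₁+T₂
      0<c₂′ : + 0 ℤ.< apexCoord ν_k μₐ w₂ δ
      0<c₂′ = subst (+ 0 ℤ.<_) (sym (trans (cong (ρ ℤ.*_) (trans (det-shift₂ s σ ρ (proj₁ r₁) (proj₂ r₁) (proj₁ r₂) (proj₂ r₂)) (cong (s ℤ.* ρ ℤ.*_) det-edges)))
        (apexCoord≡ ρ ρ²≡1))) 0<T₁+T₂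
      ∣c₀∣≤M : ∣ c₀ ∣ ℕ.≤ M
      ∣c₀∣≤M = ℕP.≤-trans (ℕP.m≤m+n ∣ c₀ ∣ ∣ c₁ ∣) (ℕP.≤-trans (ℕP.m≤m+n _ ∣ c₀′ ∣) (ℕP.m≤m+n _ ∣ c₁′ ∣))
      ∣c₁∣≤M : ∣ c₁ ∣ ℕ.≤ M
      ∣c₁∣≤M = ℕP.≤-trans (ℕP.m≤n+m ∣ c₁ ∣ ∣ c₀ ∣) (ℕP.≤-trans (ℕP.m≤m+n _ ∣ c₀′ ∣) (ℕP.m≤m+n _ ∣ c₁′ ∣))
      ∣c₀′∣≤M : ∣ c₀′ ∣ ℕ.≤ M
      ∣c₀′∣≤M = ℕP.≤-trans (ℕP.m≤n+m ∣ c₀′ ∣ (∣ c₀ ∣ ℕ.+ ∣ c₁ ∣)) (ℕP.m≤m+n _ ∣ c₁′ ∣)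
      ∣c₁′∣≤M : ∣ c₁′ ∣ ℕ.≤ M
      ∣c₁′∣≤M = ℕP.m≤n+m ∣ c₁′ ∣ (∣ c₀ ∣ ℕ.+ ∣ c₁ ∣ ℕ.+ ∣ c₀′ ∣)

  crossing-edges : ∀ {pts} Δ → UnimodularTriangulation pts Δ → ∀ i t₂ a t₁ →
    Joined Δ (ν′ i) (μ′ (a ℕ.+ suc t₁)) → Joined Δ (ν′ (i ℕ.+ suc t₂)) (μ′ a) → ⊥
  crossing-edges Δ (vertices , _ , disjoint) i t₂ a t₁ J₁ J₂ = compare (r Fin.≟ r′)
    where
    r = Any.index J₁
    r′ = Any.index J₂
    J₁∈ = AnyP.lookup-index J₁
    J₂∈ = AnyP.lookup-index J₂
    i≢k : i ≢ i ℕ.+ suc t₂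
    i≢k i≡k = ℕP.<-irrefl i≡k (ℕP.m<m+n i ℕ.z<s)
    b≢a : a ℕ.+ suc t₁ ≢ a
    b≢a b≡a = ℕP.<-irrefl (sym b≡a) (ℕP.m<m+n a ℕ.z<s)
    compare : Dec (r ≡ r′) → ⊥
    compare (yes r≡r′) =
      let J₂∈T = subst (λ r → ν′ (i ℕ.+ suc t₂) ∈V lookup Δ r × μ′ a ∈V lookup Δ r) (sym r≡r′) J₂∈
      in no-four-distinct-vertices (lookup Δ r) (proj₁ J₁∈) (proj₂ J₁∈) (proj₁ J₂∈T) (proj₂ J₂∈T)
        (ν′≢μ′ i (a ℕ.+ suc t₁)) (i≢k ∘ ν′-injective) (ν′≢μ′ i a) (λ e → ν′≢μ′ (i ℕ.+ suc t₂) (a ℕ.+ suc t₁) (sym e))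
        (b≢a ∘ μ′-injective) (ν′≢μ′ (i ℕ.+ suc t₂) a)
    compare (no r≢r′) =
      let w₁ , π₁ = edge-first (lookup Δ r) (proj₁ J₁∈) (proj₂ J₁∈) (ν′≢μ′ i (a ℕ.+ suc t₁))
          w₂ , π₂ = edge-first (lookup Δ r′) (proj₁ J₂∈) (proj₂ J₂∈) (ν′≢μ′ (i ℕ.+ suc t₂) a)
          x , x∈T₁° , x∈T₂° = crossing-interiors i t₂ a t₁ w₁ w₂
            (Unimodular-perm π₁ (proj₁ (vertices (∈-lookup r)))) (Unimodular-perm π₂ (proj₁ (vertices (∈-lookup r′))))
      in disjoint r r′ r≢r′ x (InRelInt-perm π₁ x∈T₁° , InRelInt-perm π₂ x∈T₂°)

  no-crossing : ∀ {pts} Δ → UnimodularTriangulation pts Δ → ∀ {i k a b} → i ℕ.< k → a ℕ.< b →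
    Joined Δ (ν′ i) (μ′ b) → Joined Δ (ν′ k) (μ′ a) → ⊥
  no-crossing Δ triangulation {i} {k} {a} {b} i<k a<b =
    let t₂ , k≡ = m<n⇒∃[o]n≡m+1+o i<k
        t₁ , b≡ = m<n⇒∃[o]n≡m+1+o a<b
    in subst₂ (λ k b → Joined Δ (ν′ i) (μ′ b) → Joined Δ (ν′ k) (μ′ a) → ⊥) (sym k≡) (sym b≡)
         (crossing-edges Δ triangulation i t₂ a t₁)

-- Heights

bumpDec : ∀ {A : Set} → ℕ → Dec A → ℤ
bumpDec N (yes _) = + (N ℕ.+ N)
bumpDec N (no _) = + 0

bump : ℕ → ℕ → ℤ → ℤ
bump N M u = bumpDec N (u ℤ.≟ + M)

heightτ : ℤ → ℤ
heightτ u = u ℤ.* u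

heightτ′ : ℕ → ℕ → ℤ → ℤ
heightτ′ N M u = u ℤ.* u ℤ.- u ℤ.+ bump N M u

bump-≢ : ∀ N M k → k ≢ M → bump N M (+ k) ≡ + 0
bump-≢ N M k k≢M = f (+ k ℤ.≟ + M)
  where
  f : (d : Dec (+ k ≡ + M)) → bumpDec N d ≡ + 0
  f (yes k≡M) = ⊥-elim (k≢M (ℤP.+-injective k≡M))
  f (no _) = refl

bump-≡ : ∀ N M → bump N M (+ M) ≡ + (N ℕ.+ N)
bump-≡ N M = f (+ M ℤ.≟ + M)
  where
  f : (d : Dec (+ M ≡ + M)) → bumpDec N d ≡ + (N ℕ.+ N)
  f (yes _) = refl
  f (no M≢M) = ⊥-elim (M≢M refl)

bump-nonneg : ∀ N M u → + 0 ℤ.≤ bump N M u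
bump-nonneg N M u = f (u ℤ.≟ + M)
  where
  f : (d : Dec (u ≡ + M)) → + 0 ℤ.≤ bumpDec N d
  f (yes _) = ℤ.+≤+ z≤n
  f (no _) = ℤ.+≤+ z≤n

private
  add-diff : ∀ a b → a ℤ.+ (b ℤ.- a) ≡ b
  add-diff = ℤ-Solver.solve-∀
  sub-add : ∀ a b → a ≡ (a ℤ.- b) ℤ.+ b
  sub-add = ℤ-Solver.solve-∀

<-by-gap : ∀ a b d → b ℤ.- a ≡ d → + 0 ℤ.< d → a ℤ.< b
<-by-gap a b d b-a≡d 0<d = subst₂ ℤ._<_ (ℤP.+-identityʳ a) (trans (cong (ℤ._+_ a) (sym b-a≡d)) (add-diff a b)) (ℤP.+-monoʳ-< a 0<d)

0<+0≤ : ∀ {a b} → + 0 ℤ.< a → + 0 ℤ.≤ b → + 0 ℤ.< a ℤ.+ b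
0<+0≤ 0<a 0≤b = ℤP.+-mono-<-≤ 0<a 0≤b

0<x*x : ∀ x → x ≢ + 0 → + 0 ℤ.< x ℤ.* x
0<x*x (+ zero)  x≢0 = ⊥-elim (x≢0 refl)
0<x*x (+ suc n) _   = ℤ.+<+ (s≤s z≤n)
0<x*x -[1+ n ]  _   = ℤ.+<+ (s≤s z≤n)

0<x*[x-1] : ∀ x → x ≢ + 0 → x ≢ + 1 → + 0 ℤ.< x ℤ.* (x ℤ.- + 1)
0<x*[x-1] (+ zero)        x≢0 _   = ⊥-elim (x≢0 refl)
0<x*[x-1] (+ suc zero)    _   x≢1 = ⊥-elim (x≢1 refl)
0<x*[x-1] (+ suc (suc n)) _   _   = ℤ.+<+ (s≤s z≤n)
0<x*[x-1] -[1+ n ]        _   _   = ℤ.+<+ (s≤s z≤n)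

k-i≢0 : ∀ k i → k ≢ i → + k ℤ.- + i ≢ + 0
k-i≢0 k i k≢i k-i≡0 = k≢i (ℤP.+-injective (trans (sub-add (+ k) (+ i)) (trans (cong (ℤ._+ + i) k-i≡0) (ℤP.+-identityˡ (+ i)))))

k-i≢1 : ∀ k i → k ≢ suc i → + k ℤ.- + i ≢ + 1
k-i≢1 k i k≢1+i k-i≡1 = k≢1+i (ℤP.+-injective (trans (sub-add (+ k) (+ i)) (cong (ℤ._+ + i) k-i≡1)))

slopeτ : ℕ → ℤ
slopeτ i = + 1 ℤ.+ (+ i ℤ.+ + i)

interceptτ : ℤ → ℕ → ℤ
interceptτ α i = heightτ (+ i) ℤ.- α ℤ.* + i

interceptτ′ : ℕ → ℕ → ℤ → ℕ → ℤ
interceptτ′ N M α j = heightτ′ N M (+ j) ℤ.- α ℤ.* + j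

slopeτ′ : ℕ → ℕ → ℕ → ℤ
slopeτ′ N M j = heightτ′ N M (+ suc j) ℤ.- heightτ′ N M (+ j)

heightτ′-≢ : ∀ N M k → k ≢ M → heightτ′ N M (+ k) ≡ + k ℤ.* + k ℤ.- + k
heightτ′-≢ N M k k≢M = trans (cong (λ t → + k ℤ.* + k ℤ.- + k ℤ.+ t) (bump-≢ N M k k≢M)) (ℤP.+-identityʳ _)

heightτ′-≡ : ∀ N M → heightτ′ N M (+ M) ≡ + M ℤ.* + M ℤ.- + M ℤ.+ (+ N ℤ.+ + N)
heightτ′-≡ N M = cong (λ t → + M ℤ.* + M ℤ.- + M ℤ.+ t) (bump-≡ N M)

-- Each gap identity writes height minus face height at a lattice point as a visibly positive expression.
private
  gap-τ-face-τ : ∀ K I → K ℤ.* K ℤ.- ((+ 1 ℤ.+ (I ℤ.+ I)) ℤ.* K ℤ.+ (I ℤ.* I ℤ.- (+ 1 ℤ.+ (I ℤ.+ I)) ℤ.* I)) ≡ (K ℤ.- I) ℤ.* ((K ℤ.- I) ℤ.- + 1)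
  gap-τ-face-τ = ℤ-Solver.solve-∀
  gap-τ′-face-τ : ∀ K L → K ℤ.* K ℤ.- (((((+ 1 ℤ.+ L) ℤ.* (+ 1 ℤ.+ L) ℤ.- (+ 1 ℤ.+ L)) ℤ.- (L ℤ.* L ℤ.- L))) ℤ.* K ℤ.+ (L ℤ.* L ℤ.- (((+ 1 ℤ.+ L) ℤ.* (+ 1 ℤ.+ L) ℤ.- (+ 1 ℤ.+ L)) ℤ.- (L ℤ.* L ℤ.- L)) ℤ.* L))
     ≡ (K ℤ.- L) ℤ.* (K ℤ.- L)
  gap-τ′-face-τ = ℤ-Solver.solve-∀
  gap-τ′-face-τ′ : ∀ K L bK → (K ℤ.* K ℤ.- K ℤ.+ bK) ℤ.- ((((+ 1 ℤ.+ L) ℤ.* (+ 1 ℤ.+ L) ℤ.- (+ 1 ℤ.+ L)) ℤ.- (L ℤ.* L ℤ.- L)) ℤ.* K ℤ.+ ((L ℤ.* L ℤ.- L) ℤ.- (((+ 1 ℤ.+ L) ℤ.* (+ 1 ℤ.+ L) ℤ.- (+ 1 ℤ.+ L)) ℤ.- (L ℤ.* L ℤ.- L)) ℤ.* L))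
     ≡ (K ℤ.- L) ℤ.* ((K ℤ.- L) ℤ.- + 1) ℤ.+ bK
  gap-τ′-face-τ′ = ℤ-Solver.solve-∀
  gap-τ-face-τ′ : ∀ K L bK → (K ℤ.* K ℤ.- K ℤ.+ bK) ℤ.- ((+ 1 ℤ.+ (L ℤ.+ L)) ℤ.* K ℤ.+ (((+ 1 ℤ.+ L) ℤ.* (+ 1 ℤ.+ L) ℤ.- (+ 1 ℤ.+ L)) ℤ.- (+ 1 ℤ.+ (L ℤ.+ L)) ℤ.* (+ 1 ℤ.+ L)))
     ≡ (K ℤ.- (+ 1 ℤ.+ L)) ℤ.* (K ℤ.- (+ 1 ℤ.+ L)) ℤ.+ bK
  gap-τ-face-τ′ = ℤ-Solver.solve-∀

τ-face-below-τ : ∀ i k → k ≢ i → k ≢ suc i → slopeτ i ℤ.* + k ℤ.+ interceptτ (slopeτ i) i ℤ.< heightτ (+ k)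
τ-face-below-τ i k k≢i k≢1+i = <-by-gap _ _ _ (gap-τ-face-τ (+ k) (+ i)) (0<x*[x-1] (+ k ℤ.- + i) (k-i≢0 k i k≢i) (k-i≢1 k i k≢1+i))

τ′-face-below-τ : ∀ N M l k → suc l ≢ M → l ≢ M → k ≢ l → slopeτ′ N M l ℤ.* + k ℤ.+ interceptτ (slopeτ′ N M l) l ℤ.< heightτ (+ k)
τ′-face-below-τ N M l k 1+l≢M l≢M k≢l = <-by-gap _ _ _ (trans (cong₂ F (heightτ′-≢ N M (suc l) 1+l≢M) (heightτ′-≢ N M l l≢M)) (gap-τ′-face-τ (+ k) (+ l))) (0<x*x (+ k ℤ.- + l) (k-i≢0 k l k≢l))
  where
  F : ℤ → ℤ → ℤ
  F a b = heightτ (+ k) ℤ.- ((a ℤ.- b) ℤ.* + k ℤ.+ (heightτ (+ l) ℤ.- (a ℤ.- b) ℤ.* + l))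

τ′-face-below-τ′ : ∀ N M l k → suc l ≢ M → l ≢ M → k ≢ l → k ≢ suc l → slopeτ′ N M l ℤ.* + k ℤ.+ interceptτ′ N M (slopeτ′ N M l) l ℤ.< heightτ′ N M (+ k)
τ′-face-below-τ′ N M l k 1+l≢M l≢M k≢l k≢1+l = <-by-gap _ _ _ (trans (cong₂ F (heightτ′-≢ N M (suc l) 1+l≢M) (heightτ′-≢ N M l l≢M)) (gap-τ′-face-τ′ (+ k) (+ l) (bump N M (+ k))))
  (0<+0≤ (0<x*[x-1] (+ k ℤ.- + l) (k-i≢0 k l k≢l) (k-i≢1 k l k≢1+l)) (bump-nonneg N M (+ k)))
  where
  F : ℤ → ℤ → ℤ
  F a b = heightτ′ N M (+ k) ℤ.- ((a ℤ.- b) ℤ.* + k ℤ.+ (b ℤ.- (a ℤ.- b) ℤ.* + l))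

τ-face-below-τ′ : ∀ N M l k → suc l ≢ M → k ≢ suc l → slopeτ l ℤ.* + k ℤ.+ interceptτ′ N M (slopeτ l) (suc l) ℤ.< heightτ′ N M (+ k)
τ-face-below-τ′ N M l k 1+l≢M k≢1+l = <-by-gap _ _ _ (trans (cong F (heightτ′-≢ N M (suc l) 1+l≢M)) (gap-τ-face-τ′ (+ k) (+ l) (bump N M (+ k))))
  (0<+0≤ (0<x*x (+ k ℤ.- + suc l) (k-i≢0 k (suc l) k≢1+l)) (bump-nonneg N M (+ k)))
  where
  F : ℤ → ℤ
  F a = heightτ′ N M (+ k) ℤ.- (slopeτ l ℤ.* + k ℤ.+ (a ℤ.- slopeτ l ℤ.* + suc l))

private
  gap-fan-face-τ′-before : ∀ K A B bK →
    (K ℤ.* K ℤ.- K ℤ.+ bK) ℤ.- ((+ 1 ℤ.+ ((K ℤ.+ (+ 1 ℤ.+ A) ℤ.+ B) ℤ.+ (K ℤ.+ (+ 1 ℤ.+ A) ℤ.+ B))) ℤ.* K ℤ.+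
      (((K ℤ.+ (+ 1 ℤ.+ A)) ℤ.* (K ℤ.+ (+ 1 ℤ.+ A)) ℤ.- (K ℤ.+ (+ 1 ℤ.+ A))) ℤ.- (+ 1 ℤ.+ ((K ℤ.+ (+ 1 ℤ.+ A) ℤ.+ B) ℤ.+ (K ℤ.+ (+ 1 ℤ.+ A) ℤ.+ B))) ℤ.* (K ℤ.+ (+ 1 ℤ.+ A))))
    ≡ (+ 1 ℤ.+ A) ℤ.* (+ 3 ℤ.+ A ℤ.+ B ℤ.+ B) ℤ.+ bK
  gap-fan-face-τ′-before = ℤ-Solver.solve-∀
  gap-fan-face-τ′-last : ∀ M B C →
    ((+ 1 ℤ.+ M) ℤ.* (+ 1 ℤ.+ M) ℤ.- (+ 1 ℤ.+ M) ℤ.+ ((M ℤ.+ B ℤ.+ (+ 1 ℤ.+ C)) ℤ.+ (M ℤ.+ B ℤ.+ (+ 1 ℤ.+ C))))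
      ℤ.- ((+ 1 ℤ.+ ((M ℤ.+ B) ℤ.+ (M ℤ.+ B))) ℤ.* (+ 1 ℤ.+ M) ℤ.+ ((M ℤ.* M ℤ.- M) ℤ.- (+ 1 ℤ.+ ((M ℤ.+ B) ℤ.+ (M ℤ.+ B))) ℤ.* M))
    ≡ + 1 ℤ.+ (M ℤ.+ M) ℤ.+ (C ℤ.+ C)
  gap-fan-face-τ′-last = ℤ-Solver.solve-∀

fan-face-below-τ′ : ∀ N m₂ l k → m₂ ℕ.≤ l → l ℕ.< N → k ℕ.< suc (suc m₂) → k ≢ m₂ →
  slopeτ l ℤ.* + k ℤ.+ interceptτ′ N (suc m₂) (slopeτ l) m₂ ℤ.< heightτ′ N (suc m₂) (+ k)
fan-face-below-τ′ N m₂ l k m₂≤l l<N k<2+m₂ k≢m₂ = compare-k (k ℕP.<? m₂)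
  where
  compare-k : Dec (k ℕ.< m₂) → slopeτ l ℤ.* + k ℤ.+ interceptτ′ N (suc m₂) (slopeτ l) m₂ ℤ.< heightτ′ N (suc m₂) (+ k)
  compare-k (yes k<m₂) = below-m₂ (m<n⇒∃[o]n≡m+1+o k<m₂) (m≤n⇒∃[o]n≡m+o m₂≤l)
    where
    below-m₂ : Σ[ a ∈ ℕ ] m₂ ≡ k ℕ.+ suc a → Σ[ b ∈ ℕ ] l ≡ m₂ ℕ.+ b →
      slopeτ l ℤ.* + k ℤ.+ interceptτ′ N (suc m₂) (slopeτ l) m₂ ℤ.< heightτ′ N (suc m₂) (+ k)
    below-m₂ (a , refl) (b , refl) =
      <-by-gap _ _ _ (trans (cong F (heightτ′-≢ N (suc m₂) m₂ (λ e → ℕP.1+n≢n (sym e)))) (gap-fan-face-τ′-before (+ k) (+ a) (+ b) (bump N (suc m₂) (+ k))))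
        (0<+0≤ (ℤ.+<+ (s≤s z≤n)) (bump-nonneg N (suc m₂) (+ k)))
      where
      F : ℤ → ℤ
      F t = heightτ′ N (suc m₂) (+ k) ℤ.- (slopeτ l ℤ.* + k ℤ.+ (t ℤ.- slopeτ l ℤ.* + m₂))
  compare-k (no k≮m₂) = at-1+m₂ (ℕP.≤∧≢⇒< (ℕP.≮⇒≥ k≮m₂) (λ e → k≢m₂ (sym e))) (m≤n⇒∃[o]n≡m+o m₂≤l) (m<n⇒∃[o]n≡m+1+o l<N)
    where
    at-1+m₂ : m₂ ℕ.< k → Σ[ b ∈ ℕ ] l ≡ m₂ ℕ.+ b → Σ[ c ∈ ℕ ] N ≡ l ℕ.+ suc c →
      slopeτ l ℤ.* + k ℤ.+ interceptτ′ N (suc m₂) (slopeτ l) m₂ ℤ.< heightτ′ N (suc m₂) (+ k)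
    at-1+m₂ m2k (b , refl) (c , refl) with ℕP.≤-antisym (ℕP.≤-pred k<2+m₂) m2k
    ... | refl = <-by-gap _ _ _ (trans (cong₂ F (heightτ′-≡ N (suc m₂)) (heightτ′-≢ N (suc m₂) m₂ (λ e → ℕP.1+n≢n (sym e)))) (gap-fan-face-τ′-last (+ m₂) (+ b) (+ c)))
        (ℤ.+<+ (s≤s z≤n))
      where
      F : ℤ → ℤ → ℤ
      F t u = t ℤ.- (slopeτ l ℤ.* + suc m₂ ℤ.+ (u ℤ.- slopeτ l ℤ.* + m₂))

private
  gap-last-face-τ-at-end : ∀ K A M →
    K ℤ.* K ℤ.- ((((+ 1 ℤ.+ M) ℤ.* (+ 1 ℤ.+ M) ℤ.- (+ 1 ℤ.+ M) ℤ.+ ((K ℤ.+ (+ 1 ℤ.+ A)) ℤ.+ (K ℤ.+ (+ 1 ℤ.+ A)))) ℤ.- (M ℤ.* M ℤ.- M)) ℤ.* K ℤ.+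
      ((K ℤ.+ (+ 1 ℤ.+ A)) ℤ.* (K ℤ.+ (+ 1 ℤ.+ A)) ℤ.- (((+ 1 ℤ.+ M) ℤ.* (+ 1 ℤ.+ M) ℤ.- (+ 1 ℤ.+ M) ℤ.+ ((K ℤ.+ (+ 1 ℤ.+ A)) ℤ.+ (K ℤ.+ (+ 1 ℤ.+ A)))) ℤ.- (M ℤ.* M ℤ.- M)) ℤ.* (K ℤ.+ (+ 1 ℤ.+ A))))
    ≡ (+ 1 ℤ.+ A) ℤ.* (+ 1 ℤ.+ A ℤ.+ (M ℤ.+ M))
  gap-last-face-τ-at-end = ℤ-Solver.solve-∀
  gap-last-face-τ-beyond : ∀ K A B →
    K ℤ.* K ℤ.- ((((+ 1 ℤ.+ (K ℤ.+ (+ 1 ℤ.+ A) ℤ.+ B)) ℤ.* (+ 1 ℤ.+ (K ℤ.+ (+ 1 ℤ.+ A) ℤ.+ B)) ℤ.- (+ 1 ℤ.+ (K ℤ.+ (+ 1 ℤ.+ A) ℤ.+ B))) ℤ.- ((K ℤ.+ (+ 1 ℤ.+ A) ℤ.+ B) ℤ.* (K ℤ.+ (+ 1 ℤ.+ A) ℤ.+ B) ℤ.- (K ℤ.+ (+ 1 ℤ.+ A) ℤ.+ B))) ℤ.* K ℤ.+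
      ((K ℤ.+ (+ 1 ℤ.+ A)) ℤ.* (K ℤ.+ (+ 1 ℤ.+ A)) ℤ.- (((+ 1 ℤ.+ (K ℤ.+ (+ 1 ℤ.+ A) ℤ.+ B)) ℤ.* (+ 1 ℤ.+ (K ℤ.+ (+ 1 ℤ.+ A) ℤ.+ B)) ℤ.- (+ 1 ℤ.+ (K ℤ.+ (+ 1 ℤ.+ A) ℤ.+ B))) ℤ.- ((K ℤ.+ (+ 1 ℤ.+ A) ℤ.+ B) ℤ.* (K ℤ.+ (+ 1 ℤ.+ A) ℤ.+ B) ℤ.- (K ℤ.+ (+ 1 ℤ.+ A) ℤ.+ B))) ℤ.* (K ℤ.+ (+ 1 ℤ.+ A))))
    ≡ (+ 1 ℤ.+ A) ℤ.* (+ 1 ℤ.+ A ℤ.+ (B ℤ.+ B))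
  gap-last-face-τ-beyond = ℤ-Solver.solve-∀
  gap-last-face-τ′-at-end : ∀ K A Nz →
    (K ℤ.* K ℤ.- K) ℤ.- ((((+ 1 ℤ.+ (K ℤ.+ (+ 1 ℤ.+ A))) ℤ.* (+ 1 ℤ.+ (K ℤ.+ (+ 1 ℤ.+ A))) ℤ.- (+ 1 ℤ.+ (K ℤ.+ (+ 1 ℤ.+ A))) ℤ.+ (Nz ℤ.+ Nz)) ℤ.- ((K ℤ.+ (+ 1 ℤ.+ A)) ℤ.* (K ℤ.+ (+ 1 ℤ.+ A)) ℤ.- (K ℤ.+ (+ 1 ℤ.+ A)))) ℤ.* K ℤ.+
      (((K ℤ.+ (+ 1 ℤ.+ A)) ℤ.* (K ℤ.+ (+ 1 ℤ.+ A)) ℤ.- (K ℤ.+ (+ 1 ℤ.+ A))) ℤ.- (((+ 1 ℤ.+ (K ℤ.+ (+ 1 ℤ.+ A))) ℤ.* (+ 1 ℤ.+ (K ℤ.+ (+ 1 ℤ.+ A))) ℤ.- (+ 1 ℤ.+ (K ℤ.+ (+ 1 ℤ.+ A))) ℤ.+ (Nz ℤ.+ Nz)) ℤ.- ((K ℤ.+ (+ 1 ℤ.+ A)) ℤ.* (K ℤ.+ (+ 1 ℤ.+ A)) ℤ.- (K ℤ.+ (+ 1 ℤ.+ A)))) ℤ.* (K ℤ.+ (+ 1 ℤ.+ A))))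
    ≡ (+ 1 ℤ.+ A) ℤ.* (+ 2 ℤ.+ A ℤ.+ (Nz ℤ.+ Nz))
  gap-last-face-τ′-at-end = ℤ-Solver.solve-∀

last-face-below-τ : ∀ N m₂ j k → (j ≡ m₂ ⊎ (N ℕ.≤ j × j ℕ.< m₂)) → k ℕ.< N →
  slopeτ′ N (suc m₂) j ℤ.* + k ℤ.+ interceptτ (slopeτ′ N (suc m₂) j) N ℤ.< heightτ (+ k)
last-face-below-τ N m₂ j k (inj₁ refl) k<N = gap (m<n⇒∃[o]n≡m+1+o k<N)
  where
  gap : Σ[ a ∈ ℕ ] N ≡ k ℕ.+ suc a → slopeτ′ N (suc j) j ℤ.* + k ℤ.+ interceptτ (slopeτ′ N (suc j) j) N ℤ.< heightτ (+ k)
  gap (a , refl) = <-by-gap _ _ _ (trans (cong₂ F (heightτ′-≡ (k ℕ.+ suc a) (suc j)) (heightτ′-≢ (k ℕ.+ suc a) (suc j) j (λ e → ℕP.1+n≢n (sym e)))) (gap-last-face-τ-at-end (+ k) (+ a) (+ j)))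
    (ℤ.+<+ (s≤s z≤n))
    where
    F : ℤ → ℤ → ℤ
    F t u = heightτ (+ k) ℤ.- ((t ℤ.- u) ℤ.* + k ℤ.+ (heightτ (+ (k ℕ.+ suc a)) ℤ.- (t ℤ.- u) ℤ.* + (k ℕ.+ suc a)))
last-face-below-τ N m₂ j k (inj₂ (N≤j , j<m₂)) k<N = gap (m<n⇒∃[o]n≡m+1+o k<N) (m≤n⇒∃[o]n≡m+o N≤j)
  where
  gap : Σ[ a ∈ ℕ ] N ≡ k ℕ.+ suc a → Σ[ b ∈ ℕ ] j ≡ N ℕ.+ b → slopeτ′ N (suc m₂) j ℤ.* + k ℤ.+ interceptτ (slopeτ′ N (suc m₂) j) N ℤ.< heightτ (+ k)
  gap (a , refl) (b , refl) = <-by-gap _ _ _ (trans (cong₂ F (heightτ′-≢ N′ (suc m₂) (suc j′) (λ e → ℕP.<-irrefl (ℕP.suc-injective e) j<m₂))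
                                                 (heightτ′-≢ N′ (suc m₂) j′ (λ e → ℕP.<-irrefl e (ℕP.m<n⇒m<1+n j<m₂))))
                                   (gap-last-face-τ-beyond (+ k) (+ a) (+ b)))
    (ℤ.+<+ (s≤s z≤n))
    where
    N′ = k ℕ.+ suc a
    j′ = N′ ℕ.+ b
    F : ℤ → ℤ → ℤ
    F t u = heightτ (+ k) ℤ.- ((t ℤ.- u) ℤ.* + k ℤ.+ (heightτ (+ N′) ℤ.- (t ℤ.- u) ℤ.* + N′))

last-face-below-τ′ : ∀ N m₂ j k → j ℕ.≤ m₂ → k ℕ.< suc (suc m₂) → k ≢ j → k ≢ suc j →
  slopeτ′ N (suc m₂) j ℤ.* + k ℤ.+ interceptτ′ N (suc m₂) (slopeτ′ N (suc m₂) j) j ℤ.< heightτ′ N (suc m₂) (+ k)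
last-face-below-τ′ N m₂ j k j≤m₂ k<2+m₂ k≢j k≢1+j = last-or-not (j ℕ.≟ m₂)
  where
  last-or-not : Dec (j ≡ m₂) → slopeτ′ N (suc m₂) j ℤ.* + k ℤ.+ interceptτ′ N (suc m₂) (slopeτ′ N (suc m₂) j) j ℤ.< heightτ′ N (suc m₂) (+ k)
  last-or-not (no j≢m₂) = τ′-face-below-τ′ N (suc m₂) j k (λ e → j≢m₂ (ℕP.suc-injective e)) (λ e → ℕP.<-irrefl e (ℕP.m<n⇒m<1+n (ℕP.≤∧≢⇒< j≤m₂ j≢m₂))) k≢j k≢1+j
  last-or-not (yes refl) = gap (m<n⇒∃[o]n≡m+1+o k<j)
    where
    k<j : k ℕ.< j
    k<j = ℕP.≤∧≢⇒< (ℕP.≤-pred (ℕP.≤∧≢⇒< (ℕP.≤-pred k<2+m₂) k≢1+j)) k≢j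
    gap : Σ[ a ∈ ℕ ] j ≡ k ℕ.+ suc a → slopeτ′ N (suc j) j ℤ.* + k ℤ.+ interceptτ′ N (suc j) (slopeτ′ N (suc j) j) j ℤ.< heightτ′ N (suc j) (+ k)
    gap (a , refl) = <-by-gap _ _ _ (trans (cong₃ F (heightτ′-≢ N (suc j′) k (λ e → ℕP.<-irrefl e (ℕP.m<n⇒m<1+n k<j))) (heightτ′-≡ N (suc j′)) (heightτ′-≢ N (suc j′) j′ (λ e → ℕP.1+n≢n (sym e))))
                                 (gap-last-face-τ′-at-end (+ k) (+ a) (+ N)))
      (ℤ.+<+ (s≤s z≤n))
      where
      j′ = k ℕ.+ suc a
      F : ℤ → ℤ → ℤ → ℤ
      F s t u = s ℤ.- ((t ℤ.- u) ℤ.* + k ℤ.+ (u ℤ.- (t ℤ.- u) ℤ.* + j′))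

∈-map-upTo⁺ : ∀ (f : ℕ → Pt) n k → k ℕ.< n → f k ∈L map f (upTo n)
∈-map-upTo⁺ f n k k<n = AnyP.map⁺ (AnyP.applyUpTo⁺ (λ i → i) refl k<n)

∈-map-upTo⁻ : ∀ (f : ℕ → Pt) n {z} → z ∈L map f (upTo n) → ∃ λ k → k ℕ.< n × z ≡ f k
∈-map-upTo⁻ f n z∈ = AnyP.applyUpTo⁻ (λ i → i) (AnyP.map⁻ z∈)

module StripPolygon (p q d : Pt) (∣s∣≡1 : ∣ det d (q -ᵖ p) ∣ ≡ 1) (N K : ℕ) where

  open PathTriangulation p q d ∣s∣≡1 public
  open CrossingEdges p q d ∣s∣≡1 using (no-crossing)

  n m r : ℕ
  n = suc N
  m = suc (suc (suc K))
  r = N ⊓ suc K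

  points : List Pt
  points = Cpts p q d n m

  ν′∈points : ∀ k → k ℕ.< n → ν′ k ∈L points
  ν′∈points k k<n = AnyP.++⁺ˡ (∈-map-upTo⁺ ν′ n k k<n)

  μ′∈points : ∀ k → k ℕ.< m → μ′ k ∈L points
  μ′∈points k k<m = AnyP.++⁺ʳ (τpts p d n) (∈-map-upTo⁺ μ′ m k k<m)

  points-cases : ∀ {z} → z ∈L points → (∃ λ k → k ℕ.< n × z ≡ ν′ k) ⊎ (∃ λ k → k ℕ.< m × z ≡ μ′ k)
  points-cases z∈ with AnyP.++⁻ (τpts p d n) z∈
  ... | inj₁ z∈τ  = inj₁ (∈-map-upTo⁻ ν′ n z∈τ)
  ... | inj₂ z∈τ′ = inj₂ (∈-map-upTo⁻ μ′ m z∈τ′)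

  nonneg-on-hull : ∀ {F x} → Affine F → (∀ k → k ℕ.< n → 0ℚ ℚ.≤ F (toPtℚ (ν′ k))) →
    (∀ k → k ℕ.< m → 0ℚ ℚ.≤ F (toPtℚ (μ′ k))) → InConv points x → 0ℚ ℚ.≤ F x
  nonneg-on-hull {F} aff on-τ on-τ′ = affine-nonneg-on-hull aff on-points
    where
    on-points : ∀ {z} → z ∈L points → 0ℚ ℚ.≤ F (toPtℚ z)
    on-points z∈ with points-cases z∈
    ... | inj₁ (k , k<n , refl) = on-τ k k<n
    ... | inj₂ (k , k<m , refl) = on-τ′ k k<m

  r≤N : r ℕ.≤ N
  r≤N = ℕP.m⊓n≤m N (suc K)

  r≤1+K : r ℕ.≤ suc K
  r≤1+K = ℕP.m⊓n≤n N (suc K)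

  r≤2+K : r ℕ.≤ suc (suc K)
  r≤2+K = ℕP.m≤n⇒m≤1+n r≤1+K

  Δ : List Tri
  Δ = pathTriangles 0 0 (staircase N K)

  staircase-AllSteps : ∀ {P} → (∀ l → l ℕ.< r → P l l τ′-step × P l (suc l) τ-step) →
    (∀ l → r ℕ.≤ l → l ℕ.< N → P l r τ-step) → (∀ l → r ℕ.≤ l → l ℕ.< suc (suc K) → P N l τ′-step) →
    AllSteps P 0 0 (staircase N K)
  staircase-AllSteps {P} on-stairs on-τ on-τ′ =
    AllSteps-++ 0 0 (stairs r) _ (AllSteps-stairs 0 r (λ l _ → on-stairs l))
      (subst₂ (λ i j → AllSteps P i j (replicate (N ∸ r) τ-step ++ replicate (suc (suc K) ∸ r) τ′-step))
        (sym (proj₁ (stairs-end 0 r))) (sym (proj₂ (stairs-end 0 r)))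
        (AllSteps-++ r r (replicate (N ∸ r) τ-step) _
          (AllSteps-replicate-τ r r (N ∸ r) (λ l r≤l l<r+[N∸r] → on-τ l r≤l (subst (l ℕ.<_) (ℕP.m+[n∸m]≡n r≤N) l<r+[N∸r])))
          (subst₂ (λ i j → AllSteps P i j (replicate (suc (suc K) ∸ r) τ′-step))
            (sym (trans (proj₁ (replicate-τ-end r r (N ∸ r))) (ℕP.m+[n∸m]≡n r≤N))) (sym (proj₂ (replicate-τ-end r r (N ∸ r))))
            (AllSteps-replicate-τ′ N r (suc (suc K) ∸ r)
              (λ l r≤l l<r+[2+K∸r] → on-τ′ l r≤l (subst (l ℕ.<_) (ℕP.m+[n∸m]≡n r≤2+K) l<r+[2+K∸r]))))))

  staircase-end : endᵢ 0 (staircase N K) ≡ N × endⱼ 0 (staircase N K) ≡ suc (suc K)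
  staircase-end = begin-i , begin-j
    where
    tail = replicate (N ∸ r) τ-step ++ replicate (suc (suc K) ∸ r) τ′-step
    begin-i : endᵢ 0 (staircase N K) ≡ N
    begin-i = trans (endᵢ-++ 0 (stairs r) tail) (trans (cong (λ i → endᵢ i tail) (proj₁ (stairs-end 0 r)))
      (trans (endᵢ-++ r (replicate (N ∸ r) τ-step) _) (trans (cong (λ i → endᵢ i (replicate (suc (suc K) ∸ r) τ′-step)) (proj₁ (replicate-τ-end r r (N ∸ r))))
        (trans (proj₁ (replicate-τ′-end (r ℕ.+ (N ∸ r)) r (suc (suc K) ∸ r))) (ℕP.m+[n∸m]≡n r≤N)))))
    begin-j : endⱼ 0 (staircase N K) ≡ suc (suc K)
    begin-j = trans (endⱼ-++ 0 (stairs r) tail) (trans (cong (λ j → endⱼ j tail) (proj₂ (stairs-end 0 r)))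
      (trans (endⱼ-++ r (replicate (N ∸ r) τ-step) _) (trans (cong (λ j → endⱼ j (replicate (suc (suc K) ∸ r) τ′-step)) (proj₂ (replicate-τ-end r r (N ∸ r))))
        (trans (proj₂ (replicate-τ′-end N r (suc (suc K) ∸ r))) (ℕP.m+[n∸m]≡n r≤2+K)))))

  VerticesIn : ℕ → ℕ → Step → Set
  VerticesIn i j st = ∀ v → v ∈V triangle i j st → v ∈L points

  τ-vertices : ∀ {i j} → i ℕ.< N → j ℕ.< m → VerticesIn i j τ-step
  τ-vertices {i}     i<N j<m _ (inj₁ refl)        = ν′∈points i (ℕP.m≤n⇒m≤1+n i<N)
  τ-vertices {i}     i<N j<m _ (inj₂ (inj₁ refl)) = ν′∈points (suc i) (s≤s i<N)
  τ-vertices {j = j} i<N j<m _ (inj₂ (inj₂ refl)) = μ′∈points j j<m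

  τ′-vertices : ∀ {i j} → i ℕ.< n → j ℕ.< suc (suc K) → VerticesIn i j τ′-step
  τ′-vertices {i}     i<n j<2+K _ (inj₁ refl)        = ν′∈points i i<n
  τ′-vertices {j = j} i<n j<2+K _ (inj₂ (inj₁ refl)) = μ′∈points j (ℕP.m≤n⇒m≤1+n j<2+K)
  τ′-vertices {j = j} i<n j<2+K _ (inj₂ (inj₂ refl)) = μ′∈points (suc j) (s≤s j<2+K)

  staircase-VerticesIn : AllSteps VerticesIn 0 0 (staircase N K)
  staircase-VerticesIn = staircase-AllSteps
    (λ l l<r → τ′-vertices (ℕP.<-≤-trans l<r (ℕP.m≤n⇒m≤1+n r≤N)) (ℕP.<-≤-trans l<r r≤2+K) ,
               τ-vertices (ℕP.<-≤-trans l<r r≤N) (s≤s (ℕP.<-≤-trans l<r r≤2+K)))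
    (λ l _ l<N → τ-vertices l<N (s≤s r≤2+K))
    (λ l _ l<2+K → τ′-vertices ℕP.≤-refl l<2+K)

  Δ-vertices : ∀ {T} → Any (T ≡_) Δ → Unimodular T × (∀ {v} → v ∈V T → v ∈L points)
  Δ-vertices {T} T∈Δ = from (AllSteps-∈ 0 0 (staircase N K) staircase-VerticesIn T∈Δ)
    where
    from : (∃₂ λ i j → Σ[ st ∈ Step ] (VerticesIn i j st × T ≡ triangle i j st)) →
      Unimodular T × (∀ {v} → v ∈V T → v ∈L points)
    from (i , j , st , inside , refl) = triangle-unimodular i j st , λ {v} → inside v

  private
    1-0≡1 : 1ℚ ℚ.- 0ℚ ≡ 1ℚ
    1-0≡1 = ℚP.+-identityʳ 1ℚ
    1-1≡0 : 1ℚ ℚ.- 1ℚ ≡ 0ℚ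
    1-1≡0 = ℚP.+-inverseʳ 1ℚ
    neg-sub : ∀ a b → ℚ.- (a ℚ.- b) ≡ b ℚ.- a
    neg-sub = solve-∀ ℚ-ring
    neg-neg : ∀ a → ℚ.- (ℚ.- a) ≡ a
    neg-neg = solve-∀ ℚ-ring
    one-minus : ∀ u v → 0ℚ ℚ.* u ℚ.+ (ℚ.- 1ℚ) ℚ.* v ℚ.+ 1ℚ ≡ 1ℚ ℚ.- v
    one-minus = solve-∀ ℚ-ring
    negate : ∀ a b → (ℚ.- 1ℚ) ℚ.* a ℚ.+ 0ℚ ℚ.* b ℚ.+ 0ℚ ≡ ℚ.- a
    negate = solve-∀ ℚ-ring
    0≤1 : 0ℚ ℚ.≤ 1ℚ
    0≤1 = 0≤toℚ[+n] 1

  Δ-covers : ∀ x → InConv points x → Any (λ T → InConv (verts T) x) Δ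
  Δ-covers x x∈C = subst (λ s → Any (λ T → InConv (verts T) x) (pathTriangles 0 0 s)) (sym staircase≡)
    (cover 0 0 τ′-step rest x 0≤v 0≤1-v 0≤side[0,0]
      (subst (λ s → side (endᵢ 0 s) (endⱼ 0 s) x ℚ.≤ 0ℚ) staircase≡
        (subst₂ (λ i j → side i j x ℚ.≤ 0ℚ) (sym (proj₁ staircase-end)) (sym (proj₂ staircase-end)) side[N,2+K]≤0)))
    where
    rest = proj₁ (staircase-starts-τ′ N K)
    staircase≡ = proj₂ (staircase-starts-τ′ N K)
    0≤v : 0ℚ ℚ.≤ vℚ x
    0≤v = nonneg-on-hull Affine-vℚ (λ k _ → ℚP.≤-reflexive (sym (vℚ-ν′ k))) (λ k _ → subst (0ℚ ℚ.≤_) (sym (vℚ-μ′ k)) 0≤1) x∈C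
    0≤1-v : 0ℚ ℚ.≤ 1ℚ ℚ.- vℚ x
    0≤1-v = nonneg-on-hull (Affine-≗ (affine-combination Affine-uℚ Affine-vℚ 0ℚ (ℚ.- 1ℚ) 1ℚ) (λ x → one-minus (uℚ x) (vℚ x)))
      (λ k _ → subst (0ℚ ℚ.≤_) (sym (trans (cong (ℚ._-_ 1ℚ) (vℚ-ν′ k)) 1-0≡1)) 0≤1)
      (λ k _ → ℚP.≤-reflexive (sym (trans (cong (ℚ._-_ 1ℚ) (vℚ-μ′ k)) 1-1≡0))) x∈C
    0≤side[0,0] : 0ℚ ℚ.≤ side 0 0 x
    0≤side[0,0] = nonneg-on-hull (Affine-sideAt 0ℚ 0ℚ)
      (λ k _ → subst (0ℚ ℚ.≤_) (sym (sideAt-ν′ 0ℚ 0ℚ k)) (0≤[n]-[k] {0} {k} z≤n))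
      (λ k _ → subst (0ℚ ℚ.≤_) (sym (sideAt-μ′ 0ℚ 0ℚ k)) (0≤[n]-[k] {0} {k} z≤n)) x∈C
    side[N,2+K]≤0 : side N (suc (suc K)) x ℚ.≤ 0ℚ
    side[N,2+K]≤0 = subst (ℚ._≤ 0ℚ) (neg-neg (side N (suc (suc K)) x)) (ℚP.neg-antimono-≤
      (nonneg-on-hull (Affine-≗ (affine-combination (Affine-sideAt I J) Affine-uℚ (ℚ.- 1ℚ) 0ℚ 0ℚ) (λ x → negate (sideAt I J x) (uℚ x)))
        (λ k k<n → subst (0ℚ ℚ.≤_) (sym (trans (cong ℚ.-_ (sideAt-ν′ I J k)) (neg-sub (toℚ (+ k)) I))) (0≤[n]-[k] (ℕP.≤-pred k<n)))
        (λ k k<m → subst (0ℚ ℚ.≤_) (sym (trans (cong ℚ.-_ (sideAt-μ′ I J k)) (neg-sub (toℚ (+ k)) J))) (0≤[n]-[k] (ℕP.≤-pred k<m)))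
        x∈C))
      where
      I = toℚ (+ N) ; J = toℚ (+ suc (suc K))

  Δ-triangulation : UnimodularTriangulation points Δ
  Δ-triangulation = Δ-vertices , Δ-covers , pathTriangles-disjoint 0 0 (staircase N K)

  ∈Δ-stairs : ∀ l → l ℕ.< r → Any (triangle l l τ′-step ≡_) Δ
  ∈Δ-stairs l l<r = subst (Any (triangle l l τ′-step ≡_)) (sym (pathTriangles-++ 0 0 (stairs r) _))
    (AnyP.++⁺ˡ (∈-stairs 0 r l z≤n l<r))

  ∈Δ-last : ∀ j → r ℕ.≤ j → j ℕ.< suc (suc K) → Any (triangle N j τ′-step ≡_) Δ
  ∈Δ-last j r≤j j<2+K =
    subst (Any (triangle N j τ′-step ≡_)) (sym (pathTriangles-++ 0 0 (stairs r) (τs ++ τ′s)))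
      (AnyP.++⁺ʳ (pathTriangles 0 0 (stairs r))
        (subst₂ (λ a b → Any (triangle N j τ′-step ≡_) (pathTriangles a b (τs ++ τ′s)))
          (sym (proj₁ (stairs-end 0 r))) (sym (proj₂ (stairs-end 0 r)))
          (subst (Any (triangle N j τ′-step ≡_)) (sym (pathTriangles-++ r r τs τ′s))
            (AnyP.++⁺ʳ (pathTriangles r r τs)
              (subst₂ (λ a b → Any (triangle N j τ′-step ≡_) (pathTriangles a b τ′s))
                (sym (trans (proj₁ (replicate-τ-end r r (N ∸ r))) (ℕP.m+[n∸m]≡n r≤N))) (sym (proj₂ (replicate-τ-end r r (N ∸ r))))
                (∈-replicate-τ′ N r (suc (suc K) ∸ r) j r≤j (subst (j ℕ.<_) (sym (ℕP.m+[n∸m]≡n r≤2+K)) j<2+K)))))))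
    where
    τs = replicate (N ∸ r) τ-step
    τ′s = replicate (suc (suc K) ∸ r) τ′-step

  joined-base : ∀ i j → Any (triangle i j τ′-step ≡_) Δ → Joined Δ (ν′ i) (μ′ j)
  joined-base i j = Any.map (λ { refl → inj₁ refl , inj₂ (inj₁ refl) })

  joined-apex : ∀ i j → Any (triangle i j τ′-step ≡_) Δ → Joined Δ (ν′ i) (μ′ (suc j))
  joined-apex i j = Any.map (λ { refl → inj₁ refl , inj₂ (inj₂ refl) })

  ν′0-μ′1-joined : Joined Δ (ν′ 0) (μ′ 1)
  ν′0-μ′1-joined = split (r ℕ.≟ 0)
    where
    split : Dec (r ≡ 0) → Joined Δ (ν′ 0) (μ′ 1)
    split (yes r≡0) = subst (λ i → Joined Δ (ν′ i) (μ′ 1)) (m⊓[1+n]≡0⇒m≡0 N K r≡0)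
      (joined-apex N 0 (∈Δ-last 0 (ℕP.≤-reflexive r≡0) (s≤s z≤n)))
    split (no r≢0) = joined-apex 0 0 (∈Δ-stairs 0 (ℕP.n≢0⇒n>0 r≢0))

  ν′N-μ′[1+K]-joined : Joined Δ (ν′ N) (μ′ (suc K))
  ν′N-μ′[1+K]-joined = joined-base N (suc K) (∈Δ-last (suc K) r≤1+K ℕP.≤-refl)

  τ τ′ : List Pt
  τ  = τpts p d n
  τ′ = τpts q d m

  two-neighbours : ∀ Δ′ i {a b} → a ℕ.< b → b ℕ.< m → Joined Δ′ (ν′ i) (μ′ a) → Joined Δ′ (ν′ i) (μ′ b) →
    2 ℕ.≤ nbrCount Δ′ (ν′ i) τ′
  two-neighbours Δ′ i = Counting.count-two⁺ (joined? Δ′ (ν′ i)) μ′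

  1+r≤count : suc r ℕ.≤ countJoinedTwo Δ τ τ′
  1+r≤count = subst (suc r ℕ.≤_) (sym (count-suc-yes N two-at-N)) (s≤s (ℕP.≤-trans (count-all r two-on-stairs) (count-mono r≤N)))
    where
    open Counting (λ v → 2 ℕ.≤? nbrCount Δ v τ′) ν′
    two-on-stairs : ∀ l → l ℕ.< r → 2 ℕ.≤ nbrCount Δ (ν′ l) τ′
    two-on-stairs l l<r = two-neighbours Δ l ℕP.≤-refl (s≤s (ℕP.≤-trans l<r r≤2+K))
      (joined-base l l (∈Δ-stairs l l<r)) (joined-apex l l (∈Δ-stairs l l<r))
    two-at-N : 2 ℕ.≤ nbrCount Δ (ν′ N) τ′
    two-at-N = two-neighbours Δ N ℕP.≤-refl ℕP.≤-refl
      (joined-base N (suc K) (∈Δ-last (suc K) r≤1+K ℕP.≤-refl)) (joined-apex N (suc K) (∈Δ-last (suc K) r≤1+K ℕP.≤-refl))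

  module UpperBound (Δ′ : List Tri) (triangulation : UnimodularTriangulation points Δ′) where

    open Counting (λ v → 2 ℕ.≤? nbrCount Δ′ v τ′) ν′

    -- Along τ the largest neighbours of the counted points strictly increase, since edges cannot cross.
    LargestNeighbour : ℕ → Set
    LargestNeighbour t = count t ≡ 0 ⊎ ∃₂ λ i b → i ℕ.< t × b ℕ.< m × Joined Δ′ (ν′ i) (μ′ b) × count t ℕ.≤ b

    largest-neighbour : ∀ t → LargestNeighbour t
    largest-neighbour zero    = inj₁ refl
    largest-neighbour (suc t) = step (2 ℕ.≤? nbrCount Δ′ (ν′ t) τ′) (largest-neighbour t)
      where
      extend : 2 ℕ.≤ nbrCount Δ′ (ν′ t) τ′ →
        (∃₂ λ a b → a ℕ.< b × b ℕ.< m × Joined Δ′ (ν′ t) (μ′ a) × Joined Δ′ (ν′ t) (μ′ b)) →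
        LargestNeighbour t → LargestNeighbour (suc t)
      extend two (a , b , a<b , b<m , Jₐ , J_b) (inj₁ count≡0) =
        inj₂ (t , b , ℕP.≤-refl , b<m , J_b ,
          subst (ℕ._≤ b) (sym (trans (count-suc-yes t two) (cong suc count≡0))) (ℕP.≤-trans (s≤s z≤n) a<b))
      extend two (a , b , a<b , b<m , Jₐ , J_b) (inj₂ (i , b′ , i<t , _ , J_b′ , count≤b′)) =
        inj₂ (t , b , ℕP.≤-refl , b<m , J_b ,
          subst (ℕ._≤ b) (sym (count-suc-yes t two)) (ℕP.≤-trans (s≤s (ℕP.≤-trans count≤b′ b′≤a)) a<b))
        where
        b′≤a : b′ ℕ.≤ a
        b′≤a = ℕP.≮⇒≥ (λ a<b′ → no-crossing Δ′ triangulation i<t a<b′ J_b′ Jₐ)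
      step : Dec (2 ℕ.≤ nbrCount Δ′ (ν′ t) τ′) → LargestNeighbour t → LargestNeighbour (suc t)
      step (yes two) = extend two (Counting.count-two⁻ (joined? Δ′ (ν′ t)) μ′ m two)
      step (no ¬two) (inj₁ count≡0) = inj₁ (trans (count-suc-no t ¬two) count≡0)
      step (no ¬two) (inj₂ (i , b , i<t , b<m , J , count≤b)) =
        inj₂ (i , b , ℕP.m≤n⇒m≤1+n i<t , b<m , J , subst (ℕ._≤ b) (sym (count-suc-no t ¬two)) count≤b)

    count≤2+K : count n ℕ.≤ suc (suc K)
    count≤2+K with largest-neighbour n
    ... | inj₁ count≡0 = subst (ℕ._≤ suc (suc K)) (sym count≡0) z≤n
    ... | inj₂ (_ , b , _ , b<m , _ , count≤b) = ℕP.≤-trans count≤b (ℕP.≤-pred b<m)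

    count≤1+r : countJoinedTwo Δ′ τ τ′ ℕ.≤ suc r
    count≤1+r = ℕP.⊓-glb (count≤ n) count≤2+K

  staircase-maximal : ∀ Δ′ → UnimodularTriangulation points Δ′ → countJoinedTwo Δ′ τ τ′ ℕ.≤ countJoinedTwo Δ τ τ′
  staircase-maximal Δ′ triangulation = ℕP.≤-trans (UpperBound.count≤1+r Δ′ triangulation) 1+r≤count

  M : ℕ
  M = suc (suc K)

  heightUV : ℤ → ℤ → ℤ
  heightUV u v = (+ 1 ℤ.- v) ℤ.* heightτ u ℤ.+ v ℤ.* heightτ′ N M u

  ω : Pt → ℚ
  ω z = toℚ (heightUV (U z) (V z))

  faceHeight : ℤ → ℤ → ℤ → Pt → ℤ
  faceHeight α a b z = α ℤ.* U z ℤ.+ (b ℤ.- a) ℤ.* V z ℤ.+ a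

  private
    on-τ : ∀ α k a b → α ℤ.* k ℤ.+ (b ℤ.- a) ℤ.* + 0 ℤ.+ a ≡ α ℤ.* k ℤ.+ a
    on-τ = ℤ-Solver.solve-∀
    on-τ′ : ∀ α k a b → α ℤ.* k ℤ.+ (b ℤ.- a) ℤ.* + 1 ℤ.+ a ≡ α ℤ.* k ℤ.+ b
    on-τ′ = ℤ-Solver.solve-∀
    height-on-τ : ∀ g h → (+ 1 ℤ.- + 0) ℤ.* g ℤ.+ + 0 ℤ.* h ≡ g
    height-on-τ = ℤ-Solver.solve-∀
    height-on-τ′ : ∀ g h → (+ 1 ℤ.- + 1) ℤ.* g ℤ.+ + 1 ℤ.* h ≡ h
    height-on-τ′ = ℤ-Solver.solve-∀

  faceHeight-ν′ : ∀ α a b k → faceHeight α a b (ν′ k) ≡ α ℤ.* + k ℤ.+ a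
  faceHeight-ν′ α a b k = trans (cong₂ (λ u v → α ℤ.* u ℤ.+ (b ℤ.- a) ℤ.* v ℤ.+ a) (U-ν′ k) (V-ν′ k)) (on-τ α (+ k) a b)

  faceHeight-μ′ : ∀ α a b k → faceHeight α a b (μ′ k) ≡ α ℤ.* + k ℤ.+ b
  faceHeight-μ′ α a b k = trans (cong₂ (λ u v → α ℤ.* u ℤ.+ (b ℤ.- a) ℤ.* v ℤ.+ a) (U-μ′ k) (V-μ′ k)) (on-τ′ α (+ k) a b)

  heightUV-ν′ : ∀ k → heightUV (U (ν′ k)) (V (ν′ k)) ≡ heightτ (+ k)
  heightUV-ν′ k = trans (cong₂ heightUV (U-ν′ k) (V-ν′ k)) (height-on-τ (heightτ (+ k)) (heightτ′ N M (+ k)))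

  heightUV-μ′ : ∀ k → heightUV (U (μ′ k)) (V (μ′ k)) ≡ heightτ′ N M (+ k)
  heightUV-μ′ k = trans (cong₂ heightUV (U-μ′ k) (V-μ′ k)) (height-on-τ′ (heightτ (+ k)) (heightτ′ N M (+ k)))

  LowerFace : Tri → Set
  LowerFace T = Σ[ α ∈ ℚ ] Σ[ β ∈ ℚ ] Σ[ γ ∈ ℚ ]
    ((∀ {v} → v ∈V T → affine α β γ v ≡ ω v) × (∀ {u} → u ∈L points → ¬ (u ∈V T) → affine α β γ u ℚ.< ω u))

  lower-face : ∀ T α a b → (∀ {v} → v ∈V T → faceHeight α a b v ≡ heightUV (U v) (V v)) →
    (∀ k → k ℕ.< n → ¬ (ν′ k ∈V T) → α ℤ.* + k ℤ.+ a ℤ.< heightτ (+ k)) →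
    (∀ k → k ℕ.< m → ¬ (μ′ k ∈V T) → α ℤ.* + k ℤ.+ b ℤ.< heightτ′ N M (+ k)) → LowerFace T
  lower-face T α a b on-vertices below-τ below-τ′ =
    A , B , C , (λ {v} v∈T → trans (A,B,C-affine v) (cong toℚ (on-vertices v∈T))) , below
    where
    A = proj₁ (UV-affine α (b ℤ.- a) a)
    B = proj₁ (proj₂ (UV-affine α (b ℤ.- a) a))
    C = proj₁ (proj₂ (proj₂ (UV-affine α (b ℤ.- a) a)))
    A,B,C-affine : ∀ z → affine A B C z ≡ toℚ (faceHeight α a b z)
    A,B,C-affine = proj₂ (proj₂ (proj₂ (UV-affine α (b ℤ.- a) a)))
    below : ∀ {u} → u ∈L points → ¬ (u ∈V T) → affine A B C u ℚ.< ω u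
    below u∈ u∉T with points-cases u∈
    ... | inj₁ (k , k<n , refl) = subst₂ ℚ._<_ (sym (trans (A,B,C-affine (ν′ k)) (cong toℚ (faceHeight-ν′ α a b k))))
      (cong toℚ (sym (heightUV-ν′ k))) (toℚ-mono-< (below-τ k k<n u∉T))
    ... | inj₂ (k , k<m , refl) = subst₂ ℚ._<_ (sym (trans (A,B,C-affine (μ′ k)) (cong toℚ (faceHeight-μ′ α a b k))))
      (cong toℚ (sym (heightUV-μ′ k))) (toℚ-mono-< (below-τ′ k k<m u∉T))

  private
    through-vertex : ∀ α x h → α ℤ.* x ℤ.+ (h ℤ.- α ℤ.* x) ≡ h
    through-vertex = ℤ-Solver.solve-∀
    through-next-ν : ∀ i → (+ 1 ℤ.+ (i ℤ.+ i)) ℤ.* (+ 1 ℤ.+ i) ℤ.+ (i ℤ.* i ℤ.- (+ 1 ℤ.+ (i ℤ.+ i)) ℤ.* i) ≡ (+ 1 ℤ.+ i) ℤ.* (+ 1 ℤ.+ i)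
    through-next-ν = ℤ-Solver.solve-∀
    through-next-μ : ∀ h₁ h₀ j → (h₁ ℤ.- h₀) ℤ.* (+ 1 ℤ.+ j) ℤ.+ (h₀ ℤ.- (h₁ ℤ.- h₀) ℤ.* j) ≡ h₁
    through-next-μ = ℤ-Solver.solve-∀

  τ-face-lower : ∀ i j → (∀ k → k ℕ.< m → k ≢ j → slopeτ i ℤ.* + k ℤ.+ interceptτ′ N M (slopeτ i) j ℤ.< heightτ′ N M (+ k)) →
    LowerFace (triangle i j τ-step)
  τ-face-lower i j below-τ′ = lower-face (triangle i j τ-step) α a b on-vertices
    (λ k _ k∉T → τ-face-below-τ i k (k∉T ∘ inj₁ ∘ cong ν′) (k∉T ∘ inj₂ ∘ inj₁ ∘ cong ν′))
    (λ k k<m k∉T → below-τ′ k k<m (k∉T ∘ inj₂ ∘ inj₂ ∘ cong μ′))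
    where
    α = slopeτ i
    a = interceptτ α i
    b = interceptτ′ N M α j
    on-vertices : ∀ {v} → v ∈V triangle i j τ-step → faceHeight α a b v ≡ heightUV (U v) (V v)
    on-vertices (inj₁ refl)        = trans (faceHeight-ν′ α a b i) (trans (through-vertex α (+ i) (heightτ (+ i))) (sym (heightUV-ν′ i)))
    on-vertices (inj₂ (inj₁ refl)) = trans (faceHeight-ν′ α a b (suc i)) (trans (through-next-ν (+ i)) (sym (heightUV-ν′ (suc i))))
    on-vertices (inj₂ (inj₂ refl)) = trans (faceHeight-μ′ α a b j) (trans (through-vertex α (+ j) (heightτ′ N M (+ j))) (sym (heightUV-μ′ j)))

  τ′-face-lower : ∀ i j → (∀ k → k ℕ.< n → k ≢ i → slopeτ′ N M j ℤ.* + k ℤ.+ interceptτ (slopeτ′ N M j) i ℤ.< heightτ (+ k)) →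
    (∀ k → k ℕ.< m → k ≢ j → k ≢ suc j → slopeτ′ N M j ℤ.* + k ℤ.+ interceptτ′ N M (slopeτ′ N M j) j ℤ.< heightτ′ N M (+ k)) →
    LowerFace (triangle i j τ′-step)
  τ′-face-lower i j below-τ below-τ′ = lower-face (triangle i j τ′-step) α a b on-vertices
    (λ k k<n k∉T → below-τ k k<n (k∉T ∘ inj₁ ∘ cong ν′))
    (λ k k<m k∉T → below-τ′ k k<m (k∉T ∘ inj₂ ∘ inj₁ ∘ cong μ′) (k∉T ∘ inj₂ ∘ inj₂ ∘ cong μ′))
    where
    α = slopeτ′ N M j
    a = interceptτ α i
    b = interceptτ′ N M α j
    on-vertices : ∀ {v} → v ∈V triangle i j τ′-step → faceHeight α a b v ≡ heightUV (U v) (V v)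
    on-vertices (inj₁ refl)        = trans (faceHeight-ν′ α a b i) (trans (through-vertex α (+ i) (heightτ (+ i))) (sym (heightUV-ν′ i)))
    on-vertices (inj₂ (inj₁ refl)) = trans (faceHeight-μ′ α a b j) (trans (through-vertex α (+ j) (heightτ′ N M (+ j))) (sym (heightUV-μ′ j)))
    on-vertices (inj₂ (inj₂ refl)) = trans (faceHeight-μ′ α a b (suc j))
      (trans (through-next-μ (heightτ′ N M (+ suc j)) (heightτ′ N M (+ j)) (+ j)) (sym (heightUV-μ′ (suc j))))

  r<N⇒r≡1+K : r ℕ.< N → r ≡ suc K
  r<N⇒r≡1+K r<N with ℕP.⊓-sel N (suc K)
  ... | inj₁ r≡N   = ⊥-elim (ℕP.<-irrefl r≡N r<N)
  ... | inj₂ r≡1+K = r≡1+K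

  r<1+K⇒r≡N : ∀ {j} → r ℕ.≤ j → j ℕ.< suc K → r ≡ N
  r<1+K⇒r≡N {j} r≤j j<1+K with ℕP.⊓-sel N (suc K)
  ... | inj₁ r≡N   = r≡N
  ... | inj₂ r≡1+K = ⊥-elim (ℕP.<-irrefl refl (ℕP.<-≤-trans j<1+K (subst (ℕ._≤ j) r≡1+K r≤j)))

  staircase-lower-faces : AllSteps (λ i j st → LowerFace (triangle i j st)) 0 0 (staircase N K)
  staircase-lower-faces = staircase-AllSteps on-stairs on-fan on-last
    where
    on-stairs : ∀ l → l ℕ.< r → LowerFace (triangle l l τ′-step) × LowerFace (triangle l (suc l) τ-step)
    on-stairs l l<r =
      τ′-face-lower l l (λ k _ k≢l → τ′-face-below-τ N M l k 1+l≢M l≢M k≢l) (λ k _ → τ′-face-below-τ′ N M l k 1+l≢M l≢M) ,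
      τ-face-lower l (suc l) (λ k _ → τ-face-below-τ′ N M l k 1+l≢M)
      where
      1+l<M : suc l ℕ.< M
      1+l<M = s≤s (ℕP.≤-trans l<r r≤1+K)
      1+l≢M : suc l ≢ M
      1+l≢M 1+l≡M = ℕP.<-irrefl 1+l≡M 1+l<M
      l≢M : l ≢ M
      l≢M l≡M = ℕP.<-irrefl l≡M (ℕP.<-trans (ℕP.n<1+n l) 1+l<M)
    on-fan : ∀ l → r ℕ.≤ l → l ℕ.< N → LowerFace (triangle l r τ-step)
    on-fan l r≤l l<N = subst (λ j → LowerFace (triangle l j τ-step)) (sym r≡1+K)
      (τ-face-lower l (suc K) (λ k k<m → fan-face-below-τ′ N (suc K) l k (subst (ℕ._≤ l) r≡1+K r≤l) l<N k<m))
      where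
      r≡1+K = r<N⇒r≡1+K (ℕP.≤-<-trans r≤l l<N)
    on-last : ∀ l → r ℕ.≤ l → l ℕ.< M → LowerFace (triangle N l τ′-step)
    on-last l r≤l l<M = τ′-face-lower N l
      (λ k k<n k≢N → last-face-below-τ N (suc K) l k (position (l ℕ.≟ suc K)) (ℕP.≤∧≢⇒< (ℕP.≤-pred k<n) k≢N))
      (λ k k<m → last-face-below-τ′ N (suc K) l k (ℕP.≤-pred l<M) k<m)
      where
      position : Dec (l ≡ suc K) → l ≡ suc K ⊎ (N ℕ.≤ l × l ℕ.< suc K)
      position (yes l≡1+K) = inj₁ l≡1+K
      position (no l≢1+K)  = inj₂ (subst (ℕ._≤ l) (r<1+K⇒r≡N r≤l l<1+K) r≤l , l<1+K)
        where
        l<1+K = ℕP.≤∧≢⇒< (ℕP.≤-pred l<M) l≢1+K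

  Δ-regular : Regular points Δ
  Δ-regular = ω , λ {T} T∈Δ → from (AllSteps-∈ 0 0 (staircase N K) staircase-lower-faces T∈Δ)
    where
    from : ∀ {T} → (∃₂ λ i j → Σ[ st ∈ Step ] (LowerFace (triangle i j st) × T ≡ triangle i j st)) → LowerFace T
    from (i , j , st , lower , refl) = lower


proposition4p4 : (p q d : Pt) (n m : ℕ) → 1 ≤ n → 3 ≤ m → ∣ det d (q -ᵖ p) ∣ ≡ 1 →
    Σ[ Δ ∈ List Tri ]
      ( UnimodularTriangulation (Cpts p q d n m) Δ
      × Regular (Cpts p q d n m) Δ
      × Joined Δ (ν p d 0) (ν q d 1)
      × Joined Δ (ν p d (n ∸ 1)) (ν q d (m ∸ 2))
      × ((Δ' : List Tri) → UnimodularTriangulation (Cpts p q d n m) Δ' →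
           countJoinedTwo Δ' (τpts p d n) (τpts q d m) ≤ countJoinedTwo Δ (τpts p d n) (τpts q d m)) )
proposition4p4 p q d (suc N) (suc (suc (suc K))) _ _ ∣s∣≡1 =
  Δ , Δ-triangulation , Δ-regular , ν′0-μ′1-joined , ν′N-μ′[1+K]-joined , staircase-maximal
  where open StripPolygon p q d ∣s∣≡1 N K
proposition4p4 p q d (suc N) (suc zero)       _ (s≤s ())       _
proposition4p4 p q d (suc N) (suc (suc zero)) _ (s≤s (s≤s ())) _
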